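{- Let $\zeta$ be the Riemann zeta function. For all real $\sigma\ge2$ and all real $t$, $$|\zeta(\sigma+it)|<2.$$ -}

module Defs where

open import Data.Nat.Base as ℕ using (ℕ; zero; suc; z≤n; s≤s)
import Data.Nat.Properties as ℕ
import Data.Nat.Tactic.RingSolver as ℕ-Ring
open import Data.Integer.Base as ℤ using (+_)
import Data.Integer.Properties as ℤ
open import Data.Maybe.Base using (Maybe; just; nothing)
open import Data.Product.Base using (_×_; _,_; ∃-syntax)
open import Data.Rational
open import Data.Rational.Properties
open import Data.Rational.Unnormalised.Base as ℚᵘ using (mkℚᵘ)
import Data.Rational.Unnormalised.Properties as ℚᵘ
open import Data.Sum.Base using (inj₁; inj₂)
open import Level using (0ℓ)
open import Relation.Binary.PropositionalEquality
open import Relation.Nullary using (yes; no; contradiction)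
open import Tactic.RingSolver using (solve-∀)
open import Tactic.RingSolver.Core.AlmostCommutativeRing using (AlmostCommutativeRing; fromCommutativeRing)

ℚ-ring : AlmostCommutativeRing 0ℓ 0ℓ
ℚ-ring = fromCommutativeRing +-*-commutativeRing isZero?
  where
  isZero? : ∀ x → Maybe (0ℚ ≡ x)
  isZero? x with 0ℚ ≟ x
  ... | yes p = just p
  ... | no  _ = nothing

2ℚ : ℚ
2ℚ = + 2 / 1

fromℕ : ℕ → ℚ
fromℕ n = + n / 1

1/1+_ : ℕ → ℚ
1/1+ k = + 1 / suc k

sum : (ℕ → ℚ) → ℕ → ℚ
sum f zero    = 0ℚ
sum f (suc n) = sum f n + f n

toℚᵘ-/ : ∀ i d → toℚᵘ (i / suc d) ℚᵘ.≃ mkℚᵘ i d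
toℚᵘ-/ i d = toℚᵘ-fromℚᵘ (mkℚᵘ i d)

/-≡ : ∀ a b m n → a ℕ.* suc n ≡ b ℕ.* suc m → + a / suc m ≡ + b / suc n
/-≡ a b m n eq = fromℚᵘ-cong {mkℚᵘ (+ a) m} {mkℚᵘ (+ b) n} (ℚᵘ.*≡* (begin
  + a ℤ.* + suc n   ≡⟨ ℤ.pos-* a (suc n) ⟨
  + (a ℕ.* suc n)   ≡⟨ cong +_ eq ⟩
  + (b ℕ.* suc m)   ≡⟨ ℤ.pos-* b (suc m) ⟩
  + b ℤ.* + suc m   ∎))
  where open ≡-Reasoning

/-≤ : ∀ a b m n → a ℕ.* suc n ℕ.≤ b ℕ.* suc m → + a / suc m ≤ + b / suc n
/-≤ a b m n le = toℚᵘ-cancel-≤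
  (ℚᵘ.≤-respˡ-≃ (ℚᵘ.≃-sym (toℚᵘ-/ (+ a) m))
  (ℚᵘ.≤-respʳ-≃ (ℚᵘ.≃-sym (toℚᵘ-/ (+ b) n))
  (ℚᵘ.*≤* (subst₂ ℤ._≤_ (ℤ.pos-* a (suc n)) (ℤ.pos-* b (suc m)) (ℤ.+≤+ le)))))

/-* : ∀ a b m n → (+ a / suc m) * (+ b / suc n) ≡ + (a ℕ.* b) / (suc m ℕ.* suc n)
/-* a b m n = toℚᵘ-injective (begin
  toℚᵘ ((+ a / suc m) * (+ b / suc n))            ≈⟨ toℚᵘ-homo-* (+ a / suc m) (+ b / suc n) ⟩
  toℚᵘ (+ a / suc m) ℚᵘ.* toℚᵘ (+ b / suc n)      ≈⟨ ℚᵘ.*-cong (toℚᵘ-/ (+ a) m) (toℚᵘ-/ (+ b) n) ⟩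
  mkℚᵘ (+ a) m ℚᵘ.* mkℚᵘ (+ b) n                  ≡⟨ cong (λ i → mkℚᵘ i (n ℕ.+ m ℕ.* suc n)) (ℤ.pos-* a b) ⟨
  mkℚᵘ (+ (a ℕ.* b)) (n ℕ.+ m ℕ.* suc n)          ≈⟨ toℚᵘ-/ (+ (a ℕ.* b)) (n ℕ.+ m ℕ.* suc n) ⟨
  toℚᵘ (+ (a ℕ.* b) / (suc m ℕ.* suc n))          ∎)
  where open ℚᵘ.≃-Reasoning

fromℕ-+ : ∀ a b → fromℕ (a ℕ.+ b) ≡ fromℕ a + fromℕ b
fromℕ-+ a b = toℚᵘ-injective (begin
  toℚᵘ (fromℕ (a ℕ.+ b))            ≈⟨ toℚᵘ-/ (+ (a ℕ.+ b)) 0 ⟩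
  mkℚᵘ (+ (a ℕ.+ b)) 0              ≡⟨ cong (λ i → mkℚᵘ i 0) (cong₂ ℤ._+_ (ℤ.*-identityʳ (+ a)) (ℤ.*-identityʳ (+ b))) ⟨
  mkℚᵘ (+ a) 0 ℚᵘ.+ mkℚᵘ (+ b) 0    ≈⟨ ℚᵘ.+-cong (toℚᵘ-/ (+ a) 0) (toℚᵘ-/ (+ b) 0) ⟨
  toℚᵘ (fromℕ a) ℚᵘ.+ toℚᵘ (fromℕ b) ≈⟨ toℚᵘ-homo-+ (fromℕ a) (fromℕ b) ⟨
  toℚᵘ (fromℕ a + fromℕ b)          ∎)
  where open ℚᵘ.≃-Reasoning

fromℕ-suc : ∀ n → fromℕ (suc n) ≡ fromℕ n + 1ℚ
fromℕ-suc n = trans (cong fromℕ (ℕ.+-comm 1 n)) (fromℕ-+ n 1)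

fromℕ-* : ∀ a b → fromℕ (a ℕ.* b) ≡ fromℕ a * fromℕ b
fromℕ-* a b = sym (/-* a b 0 0)

fromℕ-mono-≤ : ∀ {a b} → a ℕ.≤ b → fromℕ a ≤ fromℕ b
fromℕ-mono-≤ {a} {b} le = /-≤ a b 0 0 (ℕ.*-monoˡ-≤ 1 le)

fromℕ-nonNeg : ∀ n → 0ℚ ≤ fromℕ n
fromℕ-nonNeg n = fromℕ-mono-≤ {0} {n} z≤n

/≡*1/ : ∀ a m → + a / suc m ≡ fromℕ a * 1/1+ m
/≡*1/ a m = trans (/-≡ a (a ℕ.* 1) m (m ℕ.+ 0) (lem a m)) (sym (/-* a 1 0 m))
  where
  lem : ∀ a m → a ℕ.* suc (m ℕ.+ 0) ≡ a ℕ.* 1 ℕ.* suc m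
  lem a m = cong₂ (λ x y → x ℕ.* suc y) (sym (ℕ.*-identityʳ a)) (ℕ.+-identityʳ m)

fromℕ*1/ : ∀ k → fromℕ (suc k) * 1/1+ k ≡ 1ℚ
fromℕ*1/ k = trans (sym (/≡*1/ (suc k) k)) (/-≡ (suc k) 1 k 0 (ℕ.*-comm (suc k) 1))

1/1+-pos : ∀ k → 0ℚ < 1/1+ k
1/1+-pos k = positive⁻¹ (1/1+ k) {{normalize-pos 1 (suc k)}}

1/1+-nonNeg : ∀ k → 0ℚ ≤ 1/1+ k
1/1+-nonNeg k = <⇒≤ (1/1+-pos k)

1/1+-anti : ∀ {m n} → m ℕ.≤ n → 1/1+ n ≤ 1/1+ m
1/1+-anti {m} {n} le = /-≤ 1 1 n m (ℕ.*-monoʳ-≤ 1 (s≤s le))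

+-nonNeg : ∀ {p q} → 0ℚ ≤ p → 0ℚ ≤ q → 0ℚ ≤ p + q
+-nonNeg 0≤p 0≤q = +-mono-≤ 0≤p 0≤q

≤-*ˡ : ∀ {r p q} → 0ℚ ≤ r → p ≤ q → r * p ≤ r * q
≤-*ˡ {r} 0≤r = *-monoˡ-≤-nonNeg r {{nonNegative 0≤r}}

≤-*ʳ : ∀ {r p q} → 0ℚ ≤ r → p ≤ q → p * r ≤ q * r
≤-*ʳ {r} 0≤r = *-monoʳ-≤-nonNeg r {{nonNegative 0≤r}}

*-mono-≤′ : ∀ {p q r s} → 0ℚ ≤ r → 0ℚ ≤ q → p ≤ q → r ≤ s → p * r ≤ q * s
*-mono-≤′ 0≤r 0≤q p≤q r≤s = ≤-trans (≤-*ʳ 0≤r p≤q) (≤-*ˡ 0≤q r≤s)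

*-nonNeg : ∀ {p q} → 0ℚ ≤ p → 0ℚ ≤ q → 0ℚ ≤ p * q
*-nonNeg {p} {q} 0≤p 0≤q = subst (_≤ p * q) (*-zeroʳ p) (≤-*ˡ {p} {0ℚ} {q} 0≤p 0≤q)

*-pos : ∀ {p q} → 0ℚ < p → 0ℚ < q → 0ℚ < p * q
*-pos {p} {q} 0<p 0<q = positive⁻¹ (p * q) {{pos*pos⇒pos p {{positive 0<p}} q {{positive 0<q}}}}

p≤p+ : ∀ {p q} → 0ℚ ≤ q → p ≤ p + q
p≤p+ {p} {q} 0≤q = subst (_≤ p + q) (+-identityʳ p) (+-monoʳ-≤ p 0≤q)

q≤+q : ∀ {p q} → 0ℚ ≤ p → q ≤ p + q
q≤+q {p} {q} 0≤p = subst (_≤ p + q) (+-identityˡ q) (+-monoˡ-≤ q 0≤p)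

0<1ℚ : 0ℚ < 1ℚ
0<1ℚ = positive⁻¹ 1ℚ

0≤½ : 0ℚ ≤ ½
0≤½ = nonNegative⁻¹ ½

half-pos : ∀ {ε} → 0ℚ < ε → 0ℚ < ½ * ε
half-pos 0<ε = *-pos (positive⁻¹ ½) 0<ε

halves : ∀ ε → ½ * ε + ½ * ε ≡ ε
halves = solve-∀ ℚ-ring

∣∣-≤ : ∀ {p r} → p ≤ r → - p ≤ r → ∣ p ∣ ≤ r
∣∣-≤ {p} {r} p≤r -p≤r with ∣p∣≡p∨∣p∣≡-p p
... | inj₁ eq = subst (_≤ r) (sym eq) p≤r
... | inj₂ eq = subst (_≤ r) (sym eq) -p≤r

p≤∣p∣ : ∀ p → p ≤ ∣ p ∣
p≤∣p∣ p with ≤-total 0ℚ p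
... | inj₁ 0≤p = ≤-reflexive (sym (0≤p⇒∣p∣≡p 0≤p))
... | inj₂ p≤0 = ≤-trans p≤0 (0≤∣p∣ p)

∣p-q∣≡∣q-p∣ : ∀ p q → ∣ p - q ∣ ≡ ∣ q - p ∣
∣p-q∣≡∣q-p∣ p q = trans (cong ∣_∣ (lem p q)) (∣-p∣≡∣p∣ (q - p))
  where
  lem : ∀ p q → p - q ≡ - (q - p)
  lem = solve-∀ ℚ-ring

p-q≤r : ∀ {p q r} → p ≤ q + r → p - q ≤ r
p-q≤r {p} {q} {r} le = subst (p - q ≤_) (lem q r) (+-monoˡ-≤ (- q) le)
  where
  lem : ∀ q r → q + r - q ≡ r
  lem = solve-∀ ℚ-ring

p≤q+∣p-q∣ : ∀ p q → p ≤ q + ∣ p - q ∣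
p≤q+∣p-q∣ p q = subst (_≤ q + ∣ p - q ∣) (lem p q) (+-monoʳ-≤ q (p≤∣p∣ (p - q)))
  where
  lem : ∀ p q → q + (p - q) ≡ p
  lem = solve-∀ ℚ-ring

∣-∣-near : ∀ {p q r} → p ≤ q + r → q ≤ p + r → ∣ p - q ∣ ≤ r
∣-∣-near {p} {q} {r} p≤ q≤ = ∣∣-≤ (p-q≤r p≤) (subst (_≤ r) (lem p q) (p-q≤r q≤))
  where
  lem : ∀ p q → q - p ≡ - (p - q)
  lem = solve-∀ ℚ-ring

∣-∣-triangle : ∀ p q r → ∣ p - r ∣ ≤ ∣ p - q ∣ + ∣ q - r ∣
∣-∣-triangle p q r = subst (λ x → ∣ x ∣ ≤ ∣ p - q ∣ + ∣ q - r ∣) (lem p q r) (∣p+q∣≤∣p∣+∣q∣ (p - q) (q - r))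
  where
  lem : ∀ p q r → (p - q) + (q - r) ≡ p - r
  lem = solve-∀ ℚ-ring

split : ∀ B ε → 0ℚ < B → 0ℚ < ε → ∃[ δ ] 0ℚ < δ × B * δ ≡ ε
split B ε 0<B 0<ε = 1/B * ε , *-pos 0<1/B 0<ε , (begin
  B * (1/B * ε)   ≡⟨ *-assoc B 1/B ε ⟨
  B * 1/B * ε     ≡⟨ cong (_* ε) (*-inverseʳ B {{B≢0}}) ⟩
  1ℚ * ε          ≡⟨ *-identityˡ ε ⟩
  ε               ∎)
  where
  open ≡-Reasoning
  B≢0 : NonZero B
  B≢0 = pos⇒nonZero B {{positive 0<B}}
  1/B : ℚ
  1/B = (1/ B) {{B≢0}}
  0<1/B : 0ℚ < 1/B
  0<1/B = positive⁻¹ 1/B {{1/pos⇒pos B {{positive 0<B}}}}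

1/1+-archimedean : ∀ ε → 0ℚ < ε → ∃[ N ] 1/1+ N ≤ ε
1/1+-archimedean ε@(mkℚ (+ zero) _ _) 0<ε = contradiction (drop-*<* 0<ε) λ { (ℤ.+<+ ()) }
1/1+-archimedean ε@(mkℚ (+ suc a) d c) 0<ε = d , subst (1/1+ d ≤_) (↥p/↧p≡p ε)
  (/-≤ 1 (suc a) d d (ℕ.*-monoˡ-≤ (suc d) {1} {suc a} (s≤s z≤n)))
1/1+-archimedean ε@(mkℚ (ℤ.-[1+ a ]) _ _) 0<ε = contradiction (drop-*<* 0<ε) λ ()

*1/1+-archimedean : ∀ K ε → 0ℚ ≤ K → 0ℚ < ε → ∃[ N ] K * 1/1+ N ≤ ε
*1/1+-archimedean K ε 0≤K 0<ε =
  let K+1 = K + 1ℚ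
      0<K+1 = <-≤-trans 0<1ℚ (q≤+q 0≤K)
      (δ , 0<δ , eq) = split K+1 ε 0<K+1 0<ε
      (N , le) = 1/1+-archimedean δ 0<δ
  in N , ≤-trans (*-mono-≤′ {K} {K+1} {1/1+ N} {δ} (1/1+-nonNeg N) (<⇒≤ 0<K+1) (p≤p+ {K} {1ℚ} (<⇒≤ 0<1ℚ)) le) (≤-reflexive eq)

≤fromℕ : ∀ p → ∃[ n ] p ≤ fromℕ n
≤fromℕ p@(mkℚ (+ a) d _) = a , subst (_≤ fromℕ a) (↥p/↧p≡p p) (/-≤ a a d 0 (ℕ.*-monoʳ-≤ a (s≤s z≤n)))
≤fromℕ p@(mkℚ (ℤ.-[1+ a ]) d _) = 0 , nonPositive⁻¹ p

mono-from : ∀ (f : ℕ → ℚ) N → (∀ k → N ℕ.≤ k → f k ≤ f (suc k)) → ∀ {m n} → N ℕ.≤ m → m ℕ.≤ n → f m ≤ f n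
mono-from f N step {m} {zero} N≤m z≤n = ≤-refl
mono-from f N step {m} {suc n} N≤m m≤1+n with ℕ.m≤n⇒m<n∨m≡n m≤1+n
... | inj₁ (s≤s m≤n) = ≤-trans (mono-from f N step N≤m m≤n) (step n (ℕ.≤-trans N≤m m≤n))
... | inj₂ refl = ≤-refl

anti-from : ∀ (f : ℕ → ℚ) N → (∀ k → N ℕ.≤ k → f (suc k) ≤ f k) → ∀ {m n} → N ℕ.≤ m → m ℕ.≤ n → f n ≤ f m
anti-from f N step {m} {zero} N≤m z≤n = ≤-refl
anti-from f N step {m} {suc n} N≤m m≤1+n with ℕ.m≤n⇒m<n∨m≡n m≤1+n
... | inj₁ (s≤s m≤n) = ≤-trans (step n (ℕ.≤-trans N≤m m≤n)) (anti-from f N step N≤m m≤n)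
... | inj₂ refl = ≤-refl

IsCauchy : (ℕ → ℚ) → Set
IsCauchy x = ∀ ε → 0ℚ < ε → ∃[ N ] ∀ m n → N ℕ.≤ m → N ℕ.≤ n → ∣ x m - x n ∣ ≤ ε

-- A real number has many representing sequences, so _≡_ is not equality of
-- reals; the relations below depend only on the numbers represented.
record ℝ : Set where
  field
    seq    : ℕ → ℚ
    cauchy : IsCauchy seq
open ℝ public

infix 4 _≤ℝ_ _<ℝ_

_≤ℝ_ : ℝ → ℝ → Set
x ≤ℝ y = ∀ ε → 0ℚ < ε → ∃[ N ] ∀ n → N ℕ.≤ n → seq x n ≤ seq y n + ε

_<ℝ_ : ℝ → ℝ → Set
x <ℝ y = ∃[ ε ] 0ℚ < ε × ∃[ N ] ∀ n → N ℕ.≤ n → seq x n + ε ≤ seq y n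

fromℚ : ℚ → ℝ
fromℚ q = record
  { seq    = λ _ → q
  ; cauchy = λ ε 0<ε → 0 , λ _ _ _ _ → subst (λ p → ∣ p ∣ ≤ ε) (sym (+-inverseʳ q)) (<⇒≤ 0<ε)
  }

bounded : ∀ x → ∃[ b ] ∀ n → ∣ seq x n ∣ ≤ fromℕ b
bounded x with cauchy x 1ℚ 0<1ℚ
... | N , near = let (b , B≤b) = ≤fromℕ B in b , λ n → ≤-trans (∣x∣≤B n) B≤b
  where
  A : ℕ → ℚ
  A = sum (λ k → ∣ seq x k ∣)
  A-mono : ∀ {m n} → m ℕ.≤ n → A m ≤ A n
  A-mono = mono-from A 0 (λ k _ → p≤p+ (0≤∣p∣ (seq x k))) z≤n
  A-nonNeg : ∀ n → 0ℚ ≤ A n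
  A-nonNeg n = A-mono {0} {n} z≤n
  ∣x∣≤A : ∀ n → ∣ seq x n ∣ ≤ A (suc n)
  ∣x∣≤A n = q≤+q (A-nonNeg n)
  B : ℚ
  B = A (suc N) + 1ℚ
  lem : ∀ p q → p ≡ q + (p - q)
  lem = solve-∀ ℚ-ring
  ∣x∣≤B : ∀ n → ∣ seq x n ∣ ≤ B
  ∣x∣≤B n with ℕ.≤-total n N
  ... | inj₁ n≤N = ≤-trans (∣x∣≤A n) (≤-trans (A-mono (s≤s n≤N)) (p≤p+ (<⇒≤ 0<1ℚ)))
  ... | inj₂ N≤n = begin
    ∣ seq x n ∣                              ≡⟨ cong ∣_∣ (lem (seq x n) (seq x N)) ⟩
    ∣ seq x N + (seq x n - seq x N) ∣        ≤⟨ ∣p+q∣≤∣p∣+∣q∣ (seq x N) _ ⟩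
    ∣ seq x N ∣ + ∣ seq x n - seq x N ∣      ≤⟨ +-mono-≤ (∣x∣≤A N) (near n N N≤n ℕ.≤-refl) ⟩
    A (suc N) + 1ℚ                           ∎
    where open ≤-Reasoning

infix  8 -ℝ_
infixl 7 _*ℝ_
infixl 6 _+ℝ_

_+ℝ_ : ℝ → ℝ → ℝ
x +ℝ y = record
  { seq    = λ n → seq x n + seq y n
  ; cauchy = λ ε 0<ε →
      let (M , M-near) = cauchy x (½ * ε) (half-pos 0<ε)
          (N , N-near) = cauchy y (½ * ε) (half-pos 0<ε)
      in M ℕ.+ N , λ m n m≥ n≥ → bound {seq x m} {seq y m} {seq x n} {seq y n} (M-near m n (left M N m≥) (left M N n≥)) (N-near m n (right M N m≥) (right M N n≥))
  }
  where
  left : ∀ M N {k} → M ℕ.+ N ℕ.≤ k → M ℕ.≤ k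
  left M N = ℕ.m+n≤o⇒m≤o M
  right : ∀ M N {k} → M ℕ.+ N ℕ.≤ k → N ℕ.≤ k
  right M N = ℕ.m+n≤o⇒n≤o M
  lem : ∀ a b c d → (a - c) + (b - d) ≡ (a + b) - (c + d)
  lem = solve-∀ ℚ-ring
  bound : ∀ {a b c d ε} → ∣ a - c ∣ ≤ ½ * ε → ∣ b - d ∣ ≤ ½ * ε → ∣ (a + b) - (c + d) ∣ ≤ ε
  bound {a} {b} {c} {d} {ε} p q = begin
    ∣ (a + b) - (c + d) ∣     ≡⟨ cong ∣_∣ (lem a b c d) ⟨
    ∣ (a - c) + (b - d) ∣     ≤⟨ ∣p+q∣≤∣p∣+∣q∣ (a - c) (b - d) ⟩
    ∣ a - c ∣ + ∣ b - d ∣     ≤⟨ +-mono-≤ p q ⟩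
    ½ * ε + ½ * ε             ≡⟨ halves ε ⟩
    ε                         ∎
    where open ≤-Reasoning

-ℝ_ : ℝ → ℝ
-ℝ x = record
  { seq    = λ n → - seq x n
  ; cauchy = λ ε 0<ε → let (N , near) = cauchy x ε 0<ε in
      N , λ m n m≥ n≥ → subst (_≤ ε) (lem (seq x m) (seq x n)) (near m n m≥ n≥)
  }
  where
  lem′ : ∀ a b → - (a - b) ≡ - a - - b
  lem′ = solve-∀ ℚ-ring
  lem : ∀ a b → ∣ a - b ∣ ≡ ∣ - a - - b ∣
  lem a b = trans (sym (∣-p∣≡∣p∣ (a - b))) (cong ∣_∣ (lem′ a b))

_*ℝ_ : ℝ → ℝ → ℝ
x *ℝ y = record
  { seq    = λ n → seq x n * seq y n
  ; cauchy = λ ε 0<ε →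
      let (a , x≤a) = bounded x
          (b , y≤b) = bounded y
          B = (fromℕ a + fromℕ b) + 1ℚ
          0<B = <-≤-trans 0<1ℚ (q≤+q (+-nonNeg (fromℕ-nonNeg a) (fromℕ-nonNeg b)))
          (δ , 0<δ , Bδ≡ε) = split B ε 0<B 0<ε
          (M , M-near) = cauchy x δ 0<δ
          (N , N-near) = cauchy y δ 0<δ
      in M ℕ.+ N , λ m n m≥ n≥ → ≤-trans
           (bound a b (<⇒≤ 0<δ) (x≤a m) (y≤b n)
             (M-near m n (ℕ.m+n≤o⇒m≤o M m≥) (ℕ.m+n≤o⇒m≤o M n≥))
             (N-near m n (ℕ.m+n≤o⇒n≤o M m≥) (ℕ.m+n≤o⇒n≤o M n≥)))
           (≤-reflexive Bδ≡ε)
  }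
  where
  lem : ∀ p q r s → p * q - r * s ≡ p * (q - s) + s * (p - r)
  lem = solve-∀ ℚ-ring
  lem′ : ∀ a b δ → a * δ + b * δ + δ ≡ (a + b + 1ℚ) * δ
  lem′ = solve-∀ ℚ-ring
  bound : ∀ a b {p q r s δ} → 0ℚ ≤ δ → ∣ p ∣ ≤ fromℕ a → ∣ s ∣ ≤ fromℕ b → ∣ p - r ∣ ≤ δ → ∣ q - s ∣ ≤ δ →
          ∣ p * q - r * s ∣ ≤ (fromℕ a + fromℕ b + 1ℚ) * δ
  bound a b {p} {q} {r} {s} {δ} 0≤δ p≤a s≤b x≤δ y≤δ = begin
    ∣ p * q - r * s ∣                             ≡⟨ cong ∣_∣ (lem p q r s) ⟩
    ∣ p * (q - s) + s * (p - r) ∣                 ≤⟨ ∣p+q∣≤∣p∣+∣q∣ (p * (q - s)) (s * (p - r)) ⟩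
    ∣ p * (q - s) ∣ + ∣ s * (p - r) ∣             ≡⟨ cong₂ _+_ (∣p*q∣≡∣p∣*∣q∣ p (q - s)) (∣p*q∣≡∣p∣*∣q∣ s (p - r)) ⟩
    ∣ p ∣ * ∣ q - s ∣ + ∣ s ∣ * ∣ p - r ∣         ≤⟨ +-mono-≤ (*-mono-≤′ (0≤∣p∣ (q - s)) (fromℕ-nonNeg a) p≤a y≤δ)
                                                            (*-mono-≤′ (0≤∣p∣ (p - r)) (fromℕ-nonNeg b) s≤b x≤δ) ⟩
    fromℕ a * δ + fromℕ b * δ                     ≤⟨ p≤p+ 0≤δ ⟩
    fromℕ a * δ + fromℕ b * δ + δ                 ≡⟨ lem′ (fromℕ a) (fromℕ b) δ ⟩
    (fromℕ a + fromℕ b + 1ℚ) * δ                  ∎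
    where open ≤-Reasoning

_^_/! : ℚ → ℕ → ℚ
x ^ zero  /! = 1ℚ
x ^ suc k /! = x ^ k /! * x * 1/1+ k

^/!-nonNeg : ∀ {B} → 0ℚ ≤ B → ∀ k → 0ℚ ≤ B ^ k /!
^/!-nonNeg 0≤B zero    = <⇒≤ 0<1ℚ
^/!-nonNeg 0≤B (suc k) = *-nonNeg (*-nonNeg (^/!-nonNeg 0≤B k) 0≤B) (1/1+-nonNeg k)

^/!-abs : ∀ {x B} → ∣ x ∣ ≤ B → ∀ k → ∣ x ^ k /! ∣ ≤ B ^ k /!
^/!-abs x≤B zero = ≤-refl
^/!-abs {x} {B} x≤B (suc k) = begin
  ∣ x ^ k /! * x * 1/1+ k ∣             ≡⟨ ∣p*q∣≡∣p∣*∣q∣ (x ^ k /! * x) (1/1+ k) ⟩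
  ∣ x ^ k /! * x ∣ * ∣ 1/1+ k ∣         ≡⟨ cong₂ _*_ (∣p*q∣≡∣p∣*∣q∣ (x ^ k /!) x) (0≤p⇒∣p∣≡p (1/1+-nonNeg k)) ⟩
  ∣ x ^ k /! ∣ * ∣ x ∣ * 1/1+ k         ≤⟨ ≤-*ʳ (1/1+-nonNeg k) (*-mono-≤′ (0≤∣p∣ x) (^/!-nonNeg 0≤B k) (^/!-abs x≤B k) x≤B) ⟩
  B ^ k /! * B * 1/1+ k                 ∎
  where
  open ≤-Reasoning
  0≤B : 0ℚ ≤ B
  0≤B = ≤-trans (0≤∣p∣ x) x≤B

-- The derivative of x ^ k /! in x.
_^_/!′ : ℚ → ℕ → ℚ
x ^ zero  /!′ = 0ℚ
x ^ suc k /!′ = x ^ k /!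

^/!-lipschitz : ∀ {x y B} → ∣ x ∣ ≤ B → ∣ y ∣ ≤ B → ∀ k → ∣ x ^ k /! - y ^ k /! ∣ ≤ ∣ x - y ∣ * B ^ k /!′
^/!-lipschitz {x} {y} x≤B y≤B zero = ≤-reflexive (sym (*-zeroʳ ∣ x - y ∣))
^/!-lipschitz {x} {y} {B} x≤B y≤B (suc k) = begin
  ∣ X * x * r - Y * y * r ∣                               ≡⟨ cong ∣_∣ (lem₁ X x Y y r) ⟩
  ∣ ((X - Y) * x + Y * (x - y)) * r ∣                     ≡⟨ ∣p*q∣≡∣p∣*∣q∣ ((X - Y) * x + Y * (x - y)) r ⟩
  ∣ (X - Y) * x + Y * (x - y) ∣ * ∣ r ∣                   ≡⟨ cong (∣ (X - Y) * x + Y * (x - y) ∣ *_) (0≤p⇒∣p∣≡p (1/1+-nonNeg k)) ⟩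
  ∣ (X - Y) * x + Y * (x - y) ∣ * r                       ≤⟨ ≤-*ʳ (1/1+-nonNeg k) (begin
    ∣ (X - Y) * x + Y * (x - y) ∣                           ≤⟨ ∣p+q∣≤∣p∣+∣q∣ ((X - Y) * x) (Y * (x - y)) ⟩
    ∣ (X - Y) * x ∣ + ∣ Y * (x - y) ∣                       ≡⟨ cong₂ _+_ (∣p*q∣≡∣p∣*∣q∣ (X - Y) x) (∣p*q∣≡∣p∣*∣q∣ Y (x - y)) ⟩
    ∣ X - Y ∣ * ∣ x ∣ + ∣ Y ∣ * ∣ x - y ∣                   ≤⟨ +-mono-≤
                                                                (*-mono-≤′ (0≤∣p∣ x) (*-nonNeg 0≤h (0≤D k)) (^/!-lipschitz x≤B y≤B k) x≤B)
                                                                (≤-*ʳ 0≤h (^/!-abs y≤B k)) ⟩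
    h * B ^ k /!′ * B + B ^ k /! * h                        ≡⟨ lem₂ h (B ^ k /!′) B (B ^ k /!) ⟩
    h * (B ^ k /!′ * B + B ^ k /!)                          ≡⟨ cong (λ z → h * (z + B ^ k /!)) (D* k) ⟩
    h * (fromℕ k * B ^ k /! + B ^ k /!)                     ∎) ⟩
  h * (fromℕ k * B ^ k /! + B ^ k /!) * r                 ≡⟨ lem₃ h (fromℕ k) (B ^ k /!) r ⟩
  h * B ^ k /! * ((fromℕ k + 1ℚ) * r)                     ≡⟨ cong (λ z → h * B ^ k /! * (z * r)) (fromℕ-suc k) ⟨
  h * B ^ k /! * (fromℕ (suc k) * r)                      ≡⟨ cong (h * B ^ k /! *_) (fromℕ*1/ k) ⟩
  h * B ^ k /! * 1ℚ                                       ≡⟨ *-identityʳ (h * B ^ k /!) ⟩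
  h * B ^ k /!                                            ∎
  where
  open ≤-Reasoning
  X Y h r : ℚ
  X = x ^ k /!
  Y = y ^ k /!
  h = ∣ x - y ∣
  r = 1/1+ k
  0≤B : 0ℚ ≤ B
  0≤B = ≤-trans (0≤∣p∣ x) x≤B
  0≤h : 0ℚ ≤ h
  0≤h = 0≤∣p∣ (x - y)
  0≤D : ∀ k → 0ℚ ≤ B ^ k /!′
  0≤D zero    = ≤-refl
  0≤D (suc k) = ^/!-nonNeg 0≤B k
  lem₁ : ∀ X x Y y r → X * x * r - Y * y * r ≡ ((X - Y) * x + Y * (x - y)) * r
  lem₁ = solve-∀ ℚ-ring
  lem₂ : ∀ h D B T → h * D * B + T * h ≡ h * (D * B + T)
  lem₂ = solve-∀ ℚ-ring
  lem₃ : ∀ h k T r → h * (k * T + T) * r ≡ h * T * ((k + 1ℚ) * r)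
  lem₃ = solve-∀ ℚ-ring
  lem₄ : ∀ k T B r → k * (T * B * r) ≡ T * B * (k * r)
  lem₄ = solve-∀ ℚ-ring
  D* : ∀ k → B ^ k /!′ * B ≡ fromℕ k * B ^ k /!
  D* zero    = trans (*-zeroˡ B) (sym (*-zeroˡ 1ℚ))
  D* (suc k) = sym (trans (lem₄ (fromℕ (suc k)) (B ^ k /!) B (1/1+ k))
    (trans (cong (B ^ k /! * B *_) (fromℕ*1/ k)) (*-identityʳ (B ^ k /! * B))))

module ExpBounds (b : ℕ) where
  open ≤-Reasoning

  B : ℚ
  B = fromℕ b

  K : ℕ
  K = b ℕ.+ b

  T E : ℕ → ℚ
  T k = B ^ k /!
  E = sum T

  T-nonNeg : ∀ k → 0ℚ ≤ T k
  T-nonNeg = ^/!-nonNeg (fromℕ-nonNeg b)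

  E-mono : ∀ {m n} → m ℕ.≤ n → E m ≤ E n
  E-mono = mono-from E 0 (λ k _ → p≤p+ (T-nonNeg k)) z≤n

  B/1+k≤½ : ∀ k → K ℕ.≤ k → B * 1/1+ k ≤ ½
  B/1+k≤½ k K≤k = subst (_≤ ½) (/≡*1/ b k) (/-≤ b 1 k 1 (subst₂ ℕ._≤_ (lem b) (sym (ℕ.*-identityˡ (suc k))) (ℕ.m≤n⇒m≤1+n K≤k)))
    where
    lem : ∀ b → b ℕ.+ b ≡ b ℕ.* 2
    lem = ℕ-Ring.solve-∀

  T-halves : ∀ k → K ℕ.≤ k → T (suc k) ≤ T k * ½
  T-halves k K≤k = begin
    T k * B * 1/1+ k        ≡⟨ *-assoc (T k) B (1/1+ k) ⟩
    T k * (B * 1/1+ k)      ≤⟨ ≤-*ˡ (T-nonNeg k) (B/1+k≤½ k K≤k) ⟩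
    T k * ½                 ∎

  Φ W : ℕ → ℚ
  Φ k = E k + (T k + T k)
  W k = fromℕ (suc k) * T k

  Φ-anti : ∀ {m n} → K ℕ.≤ m → m ℕ.≤ n → Φ n ≤ Φ m
  Φ-anti = anti-from Φ K λ k K≤k → begin
    E k + T k + (T (suc k) + T (suc k))    ≤⟨ +-monoʳ-≤ (E k + T k) (+-mono-≤ (T-halves k K≤k) (T-halves k K≤k)) ⟩
    E k + T k + (T k * ½ + T k * ½)        ≡⟨ lem (E k) (T k) ⟩
    E k + (T k + T k)                      ∎
    where
    lem : ∀ e t → e + t + (t * ½ + t * ½) ≡ e + (t + t)
    lem = solve-∀ ℚ-ring

  W-anti : ∀ {m n} → K ℕ.≤ m → m ℕ.≤ n → W n ≤ W m
  W-anti = anti-from W K λ k K≤k → begin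
    fromℕ (2 ℕ.+ k) * T (suc k)            ≤⟨ ≤-*ˡ (fromℕ-nonNeg (2 ℕ.+ k)) (T-halves k K≤k) ⟩
    fromℕ (2 ℕ.+ k) * (T k * ½)            ≤⟨ ≤-*ʳ (*-nonNeg (T-nonNeg k) 0≤½) (fromℕ-mono-≤ {2 ℕ.+ k} {suc k ℕ.+ suc k} (s≤s (ℕ.m≤n+m (suc k) k))) ⟩
    fromℕ (suc k ℕ.+ suc k) * (T k * ½)    ≡⟨ cong (_* (T k * ½)) (fromℕ-+ (suc k) (suc k)) ⟩
    (fromℕ (suc k) + fromℕ (suc k)) * (T k * ½) ≡⟨ lem (fromℕ (suc k)) (T k) ⟩
    fromℕ (suc k) * T k                    ∎
    where
    lem : ∀ k t → (k + k) * (t * ½) ≡ k * t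
    lem = solve-∀ ℚ-ring

  W-nonNeg : ∀ k → 0ℚ ≤ W k
  W-nonNeg k = *-nonNeg (fromℕ-nonNeg (suc k)) (T-nonNeg k)

  T-decay : ∀ k → K ℕ.≤ k → T k ≤ W K * 1/1+ k
  T-decay k K≤k = begin
    T k                                ≡⟨ *-identityʳ (T k) ⟨
    T k * 1ℚ                           ≡⟨ cong (T k *_) (fromℕ*1/ k) ⟨
    T k * (fromℕ (suc k) * 1/1+ k)     ≡⟨ lem (T k) (fromℕ (suc k)) (1/1+ k) ⟩
    W k * 1/1+ k                       ≤⟨ ≤-*ʳ (1/1+-nonNeg k) (W-anti ℕ.≤-refl K≤k) ⟩
    W K * 1/1+ k                       ∎
    where
    lem : ∀ t k r → t * (k * r) ≡ k * t * r
    lem = solve-∀ ℚ-ring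

  E-bound : ∀ n → E n ≤ Φ K
  E-bound n with ℕ.≤-total n K
  ... | inj₁ n≤K = ≤-trans (E-mono n≤K) (p≤p+ (+-nonNeg (T-nonNeg K) (T-nonNeg K)))
  ... | inj₂ K≤n = ≤-trans (p≤p+ (+-nonNeg (T-nonNeg n) (T-nonNeg n))) (Φ-anti ℕ.≤-refl K≤n)

  E-tail : ∀ {m n} → K ℕ.≤ m → m ℕ.≤ n → E n - E m ≤ T m + T m
  E-tail {m} {n} K≤m m≤n = p-q≤r {E n} {E m} (≤-trans (p≤p+ (+-nonNeg (T-nonNeg n) (T-nonNeg n))) (Φ-anti K≤m m≤n))

module Series (c : ℕ → ℚ) (∣c∣≤1 : ∀ k → ∣ c k ∣ ≤ 1ℚ) where
  open ≤-Reasoning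

  partial : ℚ → ℕ → ℚ
  partial x = sum (λ k → c k * x ^ k /!)

  ∣c*∣≤ : ∀ k {y z} → ∣ y ∣ ≤ z → ∣ c k * y ∣ ≤ z
  ∣c*∣≤ k {y} {z} y≤z = begin
    ∣ c k * y ∣       ≡⟨ ∣p*q∣≡∣p∣*∣q∣ (c k) y ⟩
    ∣ c k ∣ * ∣ y ∣   ≤⟨ *-mono-≤′ (0≤∣p∣ y) (<⇒≤ 0<1ℚ) (∣c∣≤1 k) y≤z ⟩
    1ℚ * z            ≡⟨ *-identityˡ z ⟩
    z                 ∎

  module _ (b : ℕ) where
    open ExpBounds b

    D : ℕ → ℚ
    D = sum (B ^_/!′)

    sum-D : ∀ n → D (suc n) ≡ E n
    sum-D zero    = refl
    sum-D (suc n) = cong (_+ T n) (sum-D n)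

    D≤ : ∀ n → D n ≤ Φ K
    D≤ zero    = E-bound 0
    D≤ (suc n) = subst (_≤ Φ K) (sym (sum-D n)) (E-bound n)

    partial-lipschitz : ∀ {x y} → ∣ x ∣ ≤ B → ∣ y ∣ ≤ B → ∀ n → ∣ partial x n - partial y n ∣ ≤ ∣ x - y ∣ * D n
    partial-lipschitz {x} {y} x≤B y≤B zero = ≤-reflexive (sym (*-zeroʳ ∣ x - y ∣))
    partial-lipschitz {x} {y} x≤B y≤B (suc n) = begin
      ∣ X + c n * u - (Y + c n * v) ∣           ≡⟨ cong ∣_∣ (lem X (c n) u Y v) ⟩
      ∣ (X - Y) + c n * (u - v) ∣               ≤⟨ ∣p+q∣≤∣p∣+∣q∣ (X - Y) (c n * (u - v)) ⟩
      ∣ X - Y ∣ + ∣ c n * (u - v) ∣             ≤⟨ +-mono-≤ (partial-lipschitz x≤B y≤B n) (∣c*∣≤ n (^/!-lipschitz x≤B y≤B n)) ⟩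
      ∣ x - y ∣ * D n + ∣ x - y ∣ * B ^ n /!′   ≡⟨ *-distribˡ-+ ∣ x - y ∣ (D n) (B ^ n /!′) ⟨
      ∣ x - y ∣ * D (suc n)                     ∎
      where
      X Y u v : ℚ
      X = partial x n
      Y = partial y n
      u = x ^ n /!
      v = y ^ n /!
      lem : ∀ X c u Y v → X + c * u - (Y + c * v) ≡ (X - Y) + c * (u - v)
      lem = solve-∀ ℚ-ring

    partial-tail : ∀ {x} → ∣ x ∣ ≤ B → ∀ {m} n → m ℕ.≤ n → ∣ partial x n - partial x m ∣ ≤ E n - E m
    partial-tail {x} x≤B {m} n m≤n with ℕ.m≤n⇒m<n∨m≡n m≤n
    partial-tail {x} x≤B {m} n m≤n | inj₂ refl = subst₂ (λ p q → ∣ p ∣ ≤ q)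
      (sym (+-inverseʳ (partial x n))) (sym (+-inverseʳ (E n))) ≤-refl
    partial-tail {x} x≤B {m} (suc n) _ | inj₁ (s≤s m≤n) = begin
      ∣ partial x n + c n * x ^ n /! - partial x m ∣        ≡⟨ cong ∣_∣ (lem (partial x n) (c n * x ^ n /!) (partial x m)) ⟩
      ∣ (partial x n - partial x m) + c n * x ^ n /! ∣      ≤⟨ ∣p+q∣≤∣p∣+∣q∣ (partial x n - partial x m) (c n * x ^ n /!) ⟩
      ∣ partial x n - partial x m ∣ + ∣ c n * x ^ n /! ∣    ≤⟨ +-mono-≤ (partial-tail x≤B n m≤n) (∣c*∣≤ n (^/!-abs x≤B n)) ⟩
      (E n - E m) + T n                                     ≡⟨ lem (E n) (T n) (E m) ⟨
      E n + T n - E m                                       ∎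
      where
      lem : ∀ p q r → p + q - r ≡ (p - r) + q
      lem = solve-∀ ℚ-ring

    diagonal-near : ∀ {x y δ N m n} → 0ℚ ≤ δ → ∣ x ∣ ≤ B → ∣ y ∣ ≤ B → ∣ x - y ∣ ≤ δ → K ℕ.≤ N → N ℕ.≤ m → N ℕ.≤ n →
      ∣ partial x m - partial y n ∣ ≤ Φ K * δ + (W K + W K + W K + W K) * 1/1+ N
    diagonal-near {x} {y} {δ} {N} {m} {n} 0≤δ x≤B y≤B x-y≤δ K≤N N≤m N≤n = begin
      ∣ p - s ∣                                          ≤⟨ ∣-∣-triangle p q s ⟩
      ∣ p - q ∣ + ∣ q - s ∣                              ≤⟨ +-monoʳ-≤ ∣ p - q ∣ (∣-∣-triangle q r s) ⟩
      ∣ p - q ∣ + (∣ q - r ∣ + ∣ r - s ∣)                ≤⟨ +-mono-≤ (tail x≤B N≤m) (+-mono-≤ middle (subst (_≤ w + w) (∣p-q∣≡∣q-p∣ s r) (tail y≤B N≤n))) ⟩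
      (w + w) + (Φ K * δ + (w + w))                      ≡⟨ lem (W K) (1/1+ N) (Φ K * δ) ⟩
      Φ K * δ + (W K + W K + W K + W K) * 1/1+ N         ∎
      where
      p q r s w : ℚ
      p = partial x m
      q = partial x N
      r = partial y N
      s = partial y n
      w = W K * 1/1+ N
      lem : ∀ w r d → (w * r + w * r) + (d + (w * r + w * r)) ≡ d + (w + w + w + w) * r
      lem = solve-∀ ℚ-ring
      tail : ∀ {z k} → ∣ z ∣ ≤ B → N ℕ.≤ k → ∣ partial z k - partial z N ∣ ≤ w + w
      tail {z} {k} z≤B N≤k = ≤-trans (partial-tail z≤B k N≤k) (≤-trans (E-tail K≤N N≤k) (+-mono-≤ (T-decay N K≤N) (T-decay N K≤N)))
      middle : ∣ q - r ∣ ≤ Φ K * δ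
      middle = begin
        ∣ q - r ∣            ≤⟨ partial-lipschitz x≤B y≤B N ⟩
        ∣ x - y ∣ * D N      ≤⟨ *-mono-≤′ (0≤D N) 0≤δ x-y≤δ (D≤ N) ⟩
        δ * Φ K              ≡⟨ *-comm δ (Φ K) ⟩
        Φ K * δ              ∎
        where
        0≤D : ∀ k → 0ℚ ≤ D k
        0≤D zero    = ≤-refl
        0≤D (suc k) = subst (0ℚ ≤_) (sym (sum-D k)) (E-mono {0} {k} z≤n)

  -- Σₖ c k * x ^ k / k !, by the diagonal of the partial sums at the
  -- approximations of x; the series converges uniformly on bounded sets.
  value : ℝ → ℝ
  value x = record
    { seq    = λ n → partial (seq x n) n
    ; cauchy = λ ε 0<ε →
        let (b , x≤b) = bounded x
            open ExpBounds b
            0≤Φ = E-bound 0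
            (δ , 0<δ , eq) = split (Φ K + 1ℚ) (½ * ε) (<-≤-trans 0<1ℚ (q≤+q 0≤Φ)) (half-pos 0<ε)
            (M , near) = cauchy x δ 0<δ
            0≤W = W-nonNeg K
            (N , N≤) = *1/1+-archimedean (W K + W K + W K + W K) (½ * ε) (+-nonNeg (+-nonNeg (+-nonNeg 0≤W 0≤W) 0≤W) 0≤W) (half-pos 0<ε)
            L = M ℕ.+ N ℕ.+ K
            M≤L = ℕ.≤-trans (ℕ.m≤m+n M N) (ℕ.m≤m+n (M ℕ.+ N) K)
            N≤L = ℕ.≤-trans (ℕ.m≤n+m N M) (ℕ.m≤m+n (M ℕ.+ N) K)
        in L , λ m n L≤m L≤n → begin
          ∣ partial (seq x m) m - partial (seq x n) n ∣        ≤⟨ diagonal-near b (<⇒≤ 0<δ) (x≤b m) (x≤b n)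
                                                                    (near m n (ℕ.≤-trans M≤L L≤m) (ℕ.≤-trans M≤L L≤n))
                                                                    (ℕ.m≤n+m K (M ℕ.+ N)) L≤m L≤n ⟩
          Φ K * δ + (W K + W K + W K + W K) * 1/1+ L           ≤⟨ +-mono-≤
                                                                    (≤-trans (≤-*ʳ {δ} {Φ K} {Φ K + 1ℚ} (<⇒≤ 0<δ) (p≤p+ (<⇒≤ 0<1ℚ))) (≤-reflexive eq))
                                                                    (≤-trans (≤-*ˡ (+-nonNeg (+-nonNeg (+-nonNeg 0≤W 0≤W) 0≤W) 0≤W) (1/1+-anti N≤L)) N≤) ⟩
          ½ * ε + ½ * ε                                        ≡⟨ halves ε ⟩
          ε                                                    ∎
    }

expCoeff cosCoeff sinCoeff : ℕ → ℚ

expCoeff _ = 1ℚ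

cosCoeff 0             = 1ℚ
cosCoeff 1             = 0ℚ
cosCoeff (suc (suc k)) = - cosCoeff k

sinCoeff 0             = 0ℚ
sinCoeff 1             = 1ℚ
sinCoeff (suc (suc k)) = - sinCoeff k

∣expCoeff∣≤1 : ∀ k → ∣ expCoeff k ∣ ≤ 1ℚ
∣expCoeff∣≤1 _ = ≤-refl

∣cosCoeff∣≤1 : ∀ k → ∣ cosCoeff k ∣ ≤ 1ℚ
∣cosCoeff∣≤1 0             = ≤-refl
∣cosCoeff∣≤1 1             = <⇒≤ 0<1ℚ
∣cosCoeff∣≤1 (suc (suc k)) = subst (_≤ 1ℚ) (sym (∣-p∣≡∣p∣ (cosCoeff k))) (∣cosCoeff∣≤1 k)

∣sinCoeff∣≤1 : ∀ k → ∣ sinCoeff k ∣ ≤ 1ℚ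
∣sinCoeff∣≤1 0             = <⇒≤ 0<1ℚ
∣sinCoeff∣≤1 1             = ≤-refl
∣sinCoeff∣≤1 (suc (suc k)) = subst (_≤ 1ℚ) (sym (∣-p∣≡∣p∣ (sinCoeff k))) (∣sinCoeff∣≤1 k)

exp cos sin : ℝ → ℝ
exp = Series.value expCoeff ∣expCoeff∣≤1
cos = Series.value cosCoeff ∣cosCoeff∣≤1
sin = Series.value sinCoeff ∣sinCoeff∣≤1

H : ℕ → ℚ
H = sum 1/1+_

-- Σ_{K < j ≤ nK} 1/j with K = 1 + k: the right Riemann sum of mesh 1/K of
-- ∫₁ⁿ dx/x.
lnApprox : ℕ → ℕ → ℚ
lnApprox n k = H (n ℕ.* suc k) - H (suc k)

sum-+ : ∀ f m n → sum f (m ℕ.+ n) ≡ sum f m + sum (λ l → f (m ℕ.+ l)) n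
sum-+ f m zero = trans (cong (sum f) (ℕ.+-identityʳ m)) (sym (+-identityʳ (sum f m)))
sum-+ f m (suc n) = trans (cong (sum f) (ℕ.+-suc m n))
  (trans (cong (_+ f (m ℕ.+ n)) (sum-+ f m n)) (+-assoc (sum f m) _ (f (m ℕ.+ n))))

sum-≤ : ∀ f c n → (∀ l → l ℕ.< n → f l ≤ c) → sum f n ≤ fromℕ n * c
sum-≤ f c zero    _  = ≤-reflexive (sym (*-zeroˡ c))
sum-≤ f c (suc n) f≤ = begin
  sum f n + f n        ≤⟨ +-mono-≤ (sum-≤ f c n (λ l l<n → f≤ l (ℕ.m<n⇒m<1+n l<n))) (f≤ n ℕ.≤-refl) ⟩
  fromℕ n * c + c      ≡⟨ lem (fromℕ n) c ⟩
  (fromℕ n + 1ℚ) * c   ≡⟨ cong (_* c) (fromℕ-suc n) ⟨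
  fromℕ (suc n) * c    ∎
  where
  open ≤-Reasoning
  lem : ∀ n c → n * c + c ≡ (n + 1ℚ) * c
  lem = solve-∀ ℚ-ring

sum-≥ : ∀ f c n → (∀ l → l ℕ.< n → c ≤ f l) → fromℕ n * c ≤ sum f n
sum-≥ f c zero    _  = ≤-reflexive (*-zeroˡ c)
sum-≥ f c (suc n) f≥ = begin
  fromℕ (suc n) * c    ≡⟨ cong (_* c) (fromℕ-suc n) ⟩
  (fromℕ n + 1ℚ) * c   ≡⟨ lem (fromℕ n) c ⟨
  fromℕ n * c + c      ≤⟨ +-mono-≤ (sum-≥ f c n (λ l l<n → f≥ l (ℕ.m<n⇒m<1+n l<n))) (f≥ n ℕ.≤-refl) ⟩
  sum f n + f n        ∎
  where
  open ≤-Reasoning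
  lem : ∀ n c → n * c + c ≡ (n + 1ℚ) * c
  lem = solve-∀ ℚ-ring

module LnBounds (p : ℕ) where
  open ≤-Reasoning

  R : ℕ → ℚ
  R = lnApprox (suc p)

  block : ℕ → ℚ
  block k = sum (λ l → 1/1+ (suc p ℕ.* suc k ℕ.+ l)) (suc p)

  H-step : ∀ k → H (suc p ℕ.* suc (suc k)) ≡ H (suc p ℕ.* suc k) + block k
  H-step k = trans (cong H (lem p k)) (sum-+ 1/1+_ (suc p ℕ.* suc k) (suc p))
    where
    lem : ∀ p k → suc p ℕ.* suc (suc k) ≡ suc p ℕ.* suc k ℕ.+ suc p
    lem = ℕ-Ring.solve-∀

  scale : ∀ k → fromℕ (suc p) * 1/1+ (k ℕ.+ p ℕ.* suc k) ≡ 1/1+ k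
  scale k = trans (sym (/≡*1/ (suc p) (k ℕ.+ p ℕ.* suc k))) (/-≡ (suc p) 1 (k ℕ.+ p ℕ.* suc k) k (sym (ℕ.*-identityˡ _)))

  block-≤ : ∀ k → block k ≤ 1/1+ k
  block-≤ k = subst (block k ≤_) (scale k) (sum-≤ _ _ (suc p) λ l _ →
    1/1+-anti (ℕ.≤-trans (ℕ.n≤1+n (k ℕ.+ p ℕ.* suc k)) (ℕ.m≤m+n (suc p ℕ.* suc k) l)))

  block-≥ : ∀ k → 1/1+ (suc k) ≤ block k
  block-≥ k = subst (_≤ block k) (scale (suc k)) (sum-≥ _ _ (suc p) λ { l (s≤s l≤p) →
    1/1+-anti (subst (suc p ℕ.* suc k ℕ.+ l ℕ.≤_) (lem p k) (ℕ.+-monoʳ-≤ (suc p ℕ.* suc k) l≤p)) })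
    where
    lem : ∀ p k → suc p ℕ.* suc k ℕ.+ p ≡ suc k ℕ.+ p ℕ.* suc (suc k)
    lem = ℕ-Ring.solve-∀

  R-step : ∀ k → R (suc k) + 1/1+ (suc k) ≡ R k + block k
  R-step k = trans (cong (λ h → h - H (suc (suc k)) + 1/1+ (suc k)) (H-step k)) (lem (H (suc p ℕ.* suc k)) (block k) (H (suc k)) (1/1+ (suc k)))
    where
    lem : ∀ h b g r → h + b - (g + r) + r ≡ h - g + b
    lem = solve-∀ ℚ-ring

  R-mono : ∀ {m n} → m ℕ.≤ n → R m ≤ R n
  R-mono = mono-from R 0 (λ k _ → +-cancelʳ-≤′ (1/1+ (suc k)) (begin
    R k + 1/1+ (suc k)          ≤⟨ +-monoʳ-≤ (R k) (block-≥ k) ⟩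
    R k + block k               ≡⟨ R-step k ⟨
    R (suc k) + 1/1+ (suc k)    ∎)) z≤n
    where
    lem : ∀ x r → x + r - r ≡ x
    lem = solve-∀ ℚ-ring
    +-cancelʳ-≤′ : ∀ r {x y} → x + r ≤ y + r → x ≤ y
    +-cancelʳ-≤′ r {x} {y} le = subst₂ _≤_ (lem x r) (lem y r) (+-monoˡ-≤ (- r) le)

  R-upper : ∀ {m n} → m ℕ.≤ n → R n ≤ R m + 1/1+ m
  R-upper {m} {n} m≤n = ≤-trans (p≤p+ (1/1+-nonNeg n)) (anti-from (λ k → R k + 1/1+ k) 0
    (λ k _ → ≤-trans (≤-reflexive (R-step k)) (+-monoʳ-≤ (R k) (block-≤ k))) z≤n m≤n)

  R-near : ∀ {N} m n → N ℕ.≤ m → N ℕ.≤ n → R m ≤ R n + 1/1+ N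
  R-near {N} m n N≤m N≤n = ≤-trans (R-upper N≤m) (+-monoˡ-≤ (1/1+ N) (R-mono N≤n))

ln : (n : ℕ) .{{_ : ℕ.NonZero n}} → ℝ
ln n@(suc p) = record
  { seq    = lnApprox n
  ; cauchy = λ ε 0<ε → let (N , N≤ε) = 1/1+-archimedean ε 0<ε in
      N , λ m k N≤m N≤k → ≤-trans (∣-∣-near {R m} {R k} (R-near m k N≤m N≤k) (R-near k m N≤k N≤m)) N≤ε
  }
  where open LnBounds p

isqrt : ℕ → ℕ
isqrt zero    = 0
isqrt (suc n) with suc (isqrt n) ℕ.* suc (isqrt n) ℕ.≤? suc n
... | yes _ = suc (isqrt n)
... | no  _ = isqrt n

isqrt-lower : ∀ n → isqrt n ℕ.* isqrt n ℕ.≤ n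
isqrt-lower zero = z≤n
isqrt-lower (suc n) with suc (isqrt n) ℕ.* suc (isqrt n) ℕ.≤? suc n
... | yes le = le
... | no  _  = ℕ.m≤n⇒m≤1+n (isqrt-lower n)

isqrt-upper : ∀ n → n ℕ.< suc (isqrt n) ℕ.* suc (isqrt n)
isqrt-upper zero = s≤s z≤n
isqrt-upper (suc n) with suc (isqrt n) ℕ.* suc (isqrt n) ℕ.≤? suc n
... | yes _ = ℕ.≤-<-trans (isqrt-upper n) (ℕ.*-mono-< {r} {suc r} {r} {suc r} (ℕ.n<1+n r) (ℕ.n<1+n r))
  where
  r : ℕ
  r = suc (isqrt n)
... | no ¬le = ℕ.≰⇒> ¬le

-- √(a/d) = √(a d (1+n)²) / (d (1+n)); rounding the numerator down costs at most 1/(1+n).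
-- Negative q are sent to 0.
sqrtℚ : ℚ → ℕ → ℚ
sqrtℚ q n = + isqrt (ℤ.∣ ↥ p ∣ ℕ.* ↧ₙ p ℕ.* (suc n ℕ.* suc n)) / (↧ₙ p ℕ.* suc n)
  where
  p : ℚ
  p = 0ℚ ⊔ q

sqrtℚ-nonNeg : ∀ q n → 0ℚ ≤ sqrtℚ q n
sqrtℚ-nonNeg q n = nonNegative⁻¹ _ {{normalize-nonNeg (isqrt (ℤ.∣ ↥ (0ℚ ⊔ q) ∣ ℕ.* ↧ₙ (0ℚ ⊔ q) ℕ.* (suc n ℕ.* suc n))) (↧ₙ (0ℚ ⊔ q) ℕ.* suc n)}}

module SqrtBounds (p : ℚ) (0≤p : 0ℚ ≤ p) (n : ℕ) where
  open ≤-Reasoning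

  a d M r e : ℕ
  a = ℤ.∣ ↥ p ∣
  d = ↧ₙ p
  M = a ℕ.* d ℕ.* (suc n ℕ.* suc n)
  r = isqrt M
  e = n ℕ.+ ℚ.denominator-1 p ℕ.* suc n

  s u : ℚ
  s = + r / suc e
  u = 1/1+ e

  s≡ : s ≡ fromℕ r * u
  s≡ = /≡*1/ r e

  p≡a/d : ∀ p → 0ℚ ≤ p → p ≡ + ℤ.∣ ↥ p ∣ / ↧ₙ p
  p≡a/d p@(mkℚ (+ a) d c) _ = sym (↥p/↧p≡p p)
  p≡a/d p@(mkℚ (ℤ.-[1+ a ]) d c) 0≤p = contradiction (drop-*≤* 0≤p) λ ()

  lem₁ : ∀ a d k → a ℕ.* (1 ℕ.* (d ℕ.* k ℕ.* (d ℕ.* k))) ≡ (a ℕ.* d ℕ.* (k ℕ.* k)) ℕ.* (1 ℕ.* 1) ℕ.* d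
  lem₁ = ℕ-Ring.solve-∀

  p≡ : p ≡ fromℕ M * (u * u)
  p≡ = trans (p≡a/d p 0≤p) (trans
    (/-≡ a (M ℕ.* (1 ℕ.* 1)) (ℚ.denominator-1 p) _ (lem₁ a d (suc n)))
    (sym (trans (cong (fromℕ M *_) (/-* 1 1 e e)) (/-* M (1 ℕ.* 1) 0 _))))

  lem₂ : ∀ r u → (r * u) * (r * u) ≡ (r * r) * (u * u)
  lem₂ = solve-∀ ℚ-ring

  lem₃ : ∀ r u → ((r + 1ℚ) * (r + 1ℚ)) * (u * u) ≡ (r * u + u) * (r * u + u)
  lem₃ = solve-∀ ℚ-ring

  0≤u² : 0ℚ ≤ u * u
  0≤u² = *-nonNeg (1/1+-nonNeg e) (1/1+-nonNeg e)

  0≤s : 0ℚ ≤ s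
  0≤s = subst (0ℚ ≤_) (sym s≡) (*-nonNeg (fromℕ-nonNeg r) (1/1+-nonNeg e))

  lower : s * s ≤ p
  lower = begin
    s * s                                ≡⟨ cong₂ _*_ s≡ s≡ ⟩
    (fromℕ r * u) * (fromℕ r * u)        ≡⟨ lem₂ (fromℕ r) u ⟩
    (fromℕ r * fromℕ r) * (u * u)        ≡⟨ cong (_* (u * u)) (fromℕ-* r r) ⟨
    fromℕ (r ℕ.* r) * (u * u)            ≤⟨ ≤-*ʳ 0≤u² (fromℕ-mono-≤ {r ℕ.* r} {M} (isqrt-lower M)) ⟩
    fromℕ M * (u * u)                    ≡⟨ p≡ ⟨
    p                                    ∎

  upper : p ≤ (s + 1/1+ n) * (s + 1/1+ n)
  upper = begin
    p                                                    ≡⟨ p≡ ⟩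
    fromℕ M * (u * u)                                    ≤⟨ ≤-*ʳ 0≤u² (fromℕ-mono-≤ {M} {suc r ℕ.* suc r} (ℕ.<⇒≤ (isqrt-upper M))) ⟩
    fromℕ (suc r ℕ.* suc r) * (u * u)                    ≡⟨ cong (_* (u * u)) (trans (fromℕ-* (suc r) (suc r)) (cong₂ _*_ (fromℕ-suc r) (fromℕ-suc r))) ⟩
    ((fromℕ r + 1ℚ) * (fromℕ r + 1ℚ)) * (u * u)          ≡⟨ lem₃ (fromℕ r) u ⟩
    (fromℕ r * u + u) * (fromℕ r * u + u)                ≡⟨ cong (λ x → (x + u) * (x + u)) s≡ ⟨
    (s + u) * (s + u)                                    ≤⟨ *-mono-≤′ 0≤s+u (≤-trans 0≤s+u s+u≤) s+u≤ s+u≤ ⟩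
    (s + 1/1+ n) * (s + 1/1+ n)                          ∎
    where
    s+u≤ : s + u ≤ s + 1/1+ n
    s+u≤ = +-monoʳ-≤ s (1/1+-anti (ℕ.m≤m+n n _))
    0≤s+u : 0ℚ ≤ s + u
    0≤s+u = +-nonNeg 0≤s (1/1+-nonNeg e)

sqrtℚ-lower : ∀ q n → sqrtℚ q n * sqrtℚ q n ≤ 0ℚ ⊔ q
sqrtℚ-lower q n = SqrtBounds.lower (0ℚ ⊔ q) (p≤p⊔q 0ℚ q) n

sqrtℚ-upper : ∀ q n → 0ℚ ⊔ q ≤ (sqrtℚ q n + 1/1+ n) * (sqrtℚ q n + 1/1+ n)
sqrtℚ-upper q n = SqrtBounds.upper (0ℚ ⊔ q) (p≤p⊔q 0ℚ q) n

√ : ℝ → ℝ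
√ x = record
  { seq    = s
  ; cauchy = λ ε 0<ε →
      let η = ½ * ε
          0<η = half-pos 0<ε
          (M , near) = cauchy x (η * η) (*-pos 0<η 0<η)
          (N , N≤η) = 1/1+-archimedean η 0<η
          one-sided : ∀ m n → M ℕ.+ N ℕ.≤ m → M ℕ.+ N ℕ.≤ n → s m ≤ s n + ε
          one-sided m n m≥ n≥ = ≤-trans
            (s-near m n 0<η (near m n (ℕ.m+n≤o⇒m≤o M m≥) (ℕ.m+n≤o⇒m≤o M n≥)))
            (+-monoʳ-≤ (s n) (≤-trans
              (+-monoˡ-≤ η (≤-trans (1/1+-anti (ℕ.m+n≤o⇒n≤o M n≥)) N≤η)) (≤-reflexive (halves ε))))
      in M ℕ.+ N , λ m n m≥ n≥ → ∣-∣-near (one-sided m n m≥ n≥) (one-sided n m n≥ m≥)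
  }
  where
  s : ℕ → ℚ
  s n = sqrtℚ (seq x n) n
  ⊔-near : ∀ {p q δ} → 0ℚ ≤ δ → ∣ p - q ∣ ≤ δ → 0ℚ ⊔ p ≤ 0ℚ ⊔ q + δ
  ⊔-near {p} {q} {δ} 0≤δ le = ⊔-lub (+-nonNeg (p≤p⊔q 0ℚ q) 0≤δ)
    (≤-trans (p≤q+∣p-q∣ p q) (+-mono-≤ (p≤q⊔p 0ℚ q) le))
  lem : ∀ w η → w * w + η * η + (w * η + w * η) ≡ (w + η) * (w + η)
  lem = solve-∀ ℚ-ring
  s-near : ∀ m n {η} → 0ℚ < η → ∣ seq x m - seq x n ∣ ≤ η * η → s m ≤ s n + (1/1+ n + η)
  s-near m n {η} 0<η le = ≮⇒≥ λ lt → <-irrefl refl (begin-strict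
    v * v                                   <⟨ *-monoˡ-<-pos v {{positive 0<v}} (lt′ lt) ⟩
    s m * v                                 ≤⟨ ≤-*ˡ (sqrtℚ-nonNeg (seq x m) m) (<⇒≤ (lt′ lt)) ⟩
    s m * s m                               ≤⟨ sqrtℚ-lower (seq x m) m ⟩
    0ℚ ⊔ seq x m                            ≤⟨ ⊔-near {seq x m} {seq x n} (*-nonNeg (<⇒≤ 0<η) (<⇒≤ 0<η)) le ⟩
    0ℚ ⊔ seq x n + η * η                    ≤⟨ +-monoˡ-≤ (η * η) (sqrtℚ-upper (seq x n) n) ⟩
    w * w + η * η                           ≤⟨ p≤p+ (+-nonNeg (*-nonNeg 0≤w (<⇒≤ 0<η)) (*-nonNeg 0≤w (<⇒≤ 0<η))) ⟩
    w * w + η * η + (w * η + w * η)         ≡⟨ lem w η ⟩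
    v * v                                   ∎)
    where
    open ≤-Reasoning
    w v : ℚ
    w = s n + 1/1+ n
    v = w + η
    0≤w : 0ℚ ≤ w
    0≤w = +-nonNeg (sqrtℚ-nonNeg (seq x n) n) (1/1+-nonNeg n)
    0<v : 0ℚ < v
    0<v = <-≤-trans 0<η (q≤+q 0≤w)
    lt′ : s n + (1/1+ n + η) < s m → v < s m
    lt′ lt = subst (_< s m) (sym (+-assoc (s n) (1/1+ n) η)) lt

infix 5 _+i_

record ℂ : Set where
  constructor _+i_
  field
    re im : ℝ
open ℂ public

0ℂ : ℂ
0ℂ = fromℚ 0ℚ +i fromℚ 0ℚ

infixl 6 _+ℂ_ _-ℂ_
infixl 7 _·_

_+ℂ_ _-ℂ_ : ℂ → ℂ → ℂ
(a +i b) +ℂ (c +i d) = (a +ℝ c) +i (b +ℝ d)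
(a +i b) -ℂ (c +i d) = (a +ℝ -ℝ c) +i (b +ℝ -ℝ d)

_·_ : ℝ → ℂ → ℂ
r · (a +i b) = (r *ℝ a) +i (r *ℝ b)

∣_∣ℂ : ℂ → ℝ
∣ a +i b ∣ℂ = √ (a *ℝ a +ℝ b *ℝ b)

expℂ : ℂ → ℂ
expℂ (a +i b) = exp a · (cos b +i sin b)

_⟶_ : (ℕ → ℂ) → ℂ → Set
f ⟶ z = ∀ ε → 0ℚ < ε → ∃[ N ] ∀ n → N ℕ.≤ n → ∣ f n -ℂ z ∣ℂ <ℝ fromℚ ε

infix 8 _^-_

_^-_ : (n : ℕ) .{{_ : ℕ.NonZero n}} → ℂ → ℂ
n ^- s = expℂ ((-ℝ ln n) · s)

ζ-partial : ℂ → ℕ → ℂ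
ζ-partial s zero    = 0ℂ
ζ-partial s (suc N) = ζ-partial s N +ℂ suc N ^- s

-- The graph of ζ on Re s > 1, which is where the Dirichlet series Σ n⁻ˢ
-- converges.
ζ[_]≈_ : ℂ → ℂ → Set
ζ[ s ]≈ z = ζ-partial s ⟶ z

{-# OPTIONS --safe #-}

-- Termwise |n⁻ˢ| = exp (- σ ln n) ≤ 1/n², and Σ 1/n² ≤ 1 + 1/4 + 2/3 < 2, where the
-- tail of the squares is compared with the telescoping bound 2/(n + 1).
-- The modulus of n⁻ˢ rests on cos² + sin² ≤ 1 and exp x · exp (- x) = 1: the square
-- of partial sums differs from the triangle of terms with i + j < n, where everything
-- but the term (0 , 0) cancels, by at most a tail of the exponential series. The growth
-- exp (ln n) ≥ n holds because exp h ≥ 1 + h turns the Riemann sum Σ 1/i for ln n into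
-- the telescoping product Π (1 + 1/i).
module Submission where

open import Defs
open import Data.Nat.Base as ℕ using (ℕ; zero; suc; z≤n; s≤s)
import Data.Nat.Properties as ℕ
open import Data.Product.Base using (_×_; _,_; ∃-syntax; proj₁; proj₂)
open import Data.Rational
open import Data.Rational.Properties
open import Data.Sum.Base using (inj₁; inj₂)
open import Data.Unit.Base using (tt)
open import Relation.Binary.PropositionalEquality
open import Relation.Nullary using (contradiction)
open import Relation.Nullary.Decidable using (toWitness)
open import Tactic.RingSolver using (solve-∀)

-- Cauchy products

-- `seq (exp x) n` is the `n`-th partial sum at the `n`-th approximation of `x`, so an identity such
-- as exp x · exp (- x) = 1 need not hold at any finite index. The laws of exp, cos and sin are
-- therefore proved as one-sided inequalities between rationals at index `n`, with an error
-- `D * 1/1+ n` whose constant depends only on a bound for the approximations. Complex moduli are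
-- compared in the same way, through squared norms of rationals; square roots enter only in the
-- passage to and from `∣_∣ℂ`. As ζ is given by its graph, a value has to be constructed too: the
-- comparison with Σ 1/n² that bounds the sum also makes the partial sums uniformly Cauchy.

p-q≤r-q : ∀ {p q r} → p ≤ r → p - q ≤ r - q
p-q≤r-q {p} {q} = +-monoˡ-≤ (- q)

0≤p-q : ∀ {p q} → q ≤ p → 0ℚ ≤ p - q
0≤p-q {p} {q} q≤p = subst (_≤ p - q) (+-inverseʳ q) (+-monoˡ-≤ (- q) q≤p)

sum-suc : ∀ f n → sum f (suc n) ≡ f 0 + sum (λ l → f (suc l)) n
sum-suc f n = trans (sum-+ f 1 n) (cong (_+ sum (λ l → f (suc l)) n) (+-identityˡ (f 0)))

sum-cong : ∀ {f g} → (∀ k → f k ≡ g k) → ∀ n → sum f n ≡ sum g n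
sum-cong f≡g zero    = refl
sum-cong f≡g (suc n) = cong₂ _+_ (sum-cong f≡g n) (f≡g n)

sum-mono : ∀ {f g} → (∀ k → f k ≤ g k) → ∀ n → sum f n ≤ sum g n
sum-mono f≤g zero    = ≤-refl
sum-mono f≤g (suc n) = +-mono-≤ (sum-mono f≤g n) (f≤g n)

sum-extend : ∀ {f} → (∀ k → 0ℚ ≤ f k) → ∀ {m n} → m ℕ.≤ n → sum f m ≤ sum f n
sum-extend {f} 0≤f = mono-from (sum f) 0 (λ k _ → p≤p+ (0≤f k)) z≤n

sum-nonNeg : ∀ {f} → (∀ k → 0ℚ ≤ f k) → ∀ n → 0ℚ ≤ sum f n
sum-nonNeg 0≤f n = sum-extend 0≤f {0} {n} z≤n

sum-+-distrib : ∀ f g n → sum (λ k → f k + g k) n ≡ sum f n + sum g n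
sum-+-distrib f g zero    = refl
sum-+-distrib f g (suc n) = trans (cong (_+ (f n + g n)) (sum-+-distrib f g n)) (lem (sum f n) (sum g n) (f n) (g n))
  where
  lem : ∀ p q r s → p + q + (r + s) ≡ p + r + (q + s)
  lem = solve-∀ ℚ-ring

sum-sub : ∀ f g n → sum (λ k → f k - g k) n ≡ sum f n - sum g n
sum-sub f g zero    = refl
sum-sub f g (suc n) = trans (cong (_+ (f n - g n)) (sum-sub f g n)) (lem (sum f n) (sum g n) (f n) (g n))
  where
  lem : ∀ p q r s → p - q + (r - s) ≡ p + r - (q + s)
  lem = solve-∀ ℚ-ring

sum-scale : ∀ c f n → sum (λ k → c * f k) n ≡ c * sum f n
sum-scale c f zero    = sym (*-zeroʳ c)
sum-scale c f (suc n) = trans (cong (_+ c * f n) (sum-scale c f n)) (sym (*-distribˡ-+ c (sum f n) (f n)))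

-- Sums of a doubly indexed family over an antidiagonal i + j = n, over the
-- triangle i + j < n and over the rectangle i < m, j < n.
conv tri : (ℕ → ℕ → ℚ) → ℕ → ℚ

conv f zero    = f 0 0
conv f (suc n) = f 0 (suc n) + conv (λ i → f (suc i)) n

tri f zero    = 0ℚ
tri f (suc n) = sum (f 0) (suc n) + tri (λ i → f (suc i)) n

rect : (ℕ → ℕ → ℚ) → ℕ → ℕ → ℚ
rect f zero    n = 0ℚ
rect f (suc m) n = sum (f 0) n + rect (λ i → f (suc i)) m n

-- The definition of `tri` goes row by row, which suits comparison with `rect`; here the triangle
-- grows by an antidiagonal, which suits `conv`.
tri-suc : ∀ f n → tri f (suc n) ≡ tri f n + conv f n
tri-suc f zero    = lem (f 0 0)
  where
  lem : ∀ x → 0ℚ + x + 0ℚ ≡ 0ℚ + x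
  lem = solve-∀ ℚ-ring
tri-suc f (suc n) = trans (cong (sum (f 0) (suc (suc n)) +_) (tri-suc (λ i → f (suc i)) n))
  (lem (sum (f 0) (suc n)) (f 0 (suc n)) _ _)
  where
  lem : ∀ p q r s → p + q + (r + s) ≡ p + r + (q + s)
  lem = solve-∀ ℚ-ring

tri≡sum : ∀ f n → tri f n ≡ sum (conv f) n
tri≡sum f zero    = refl
tri≡sum f (suc n) = trans (tri-suc f n) (cong (_+ conv f n) (tri≡sum f n))

tri-sub : ∀ f g n → tri (λ i j → f i j - g i j) n ≡ tri f n - tri g n
tri-sub f g zero    = refl
tri-sub f g (suc n) = trans
  (cong₂ _+_ (sum-sub (f 0) (g 0) (suc n)) (tri-sub (λ i → f (suc i)) (λ i → g (suc i)) n))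
  (lem (sum (f 0) (suc n)) (sum (g 0) (suc n)) _ _)
  where
  lem : ∀ p q r s → p - q + (r - s) ≡ p + r - (q + s)
  lem = solve-∀ ℚ-ring

rect-sub : ∀ f g m n → rect (λ i j → f i j - g i j) m n ≡ rect f m n - rect g m n
rect-sub f g zero    n = refl
rect-sub f g (suc m) n = trans
  (cong₂ _+_ (sum-sub (f 0) (g 0) n) (rect-sub (λ i → f (suc i)) (λ i → g (suc i)) m n))
  (lem (sum (f 0) n) (sum (g 0) n) _ _)
  where
  lem : ∀ p q r s → p - q + (r - s) ≡ p + r - (q + s)
  lem = solve-∀ ℚ-ring

rect-+ : ∀ f g m n → rect (λ i j → f i j + g i j) m n ≡ rect f m n + rect g m n
rect-+ f g zero    n = refl
rect-+ f g (suc m) n = trans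
  (cong₂ _+_ (sum-+-distrib (f 0) (g 0) n) (rect-+ (λ i → f (suc i)) (λ i → g (suc i)) m n))
  (lem (sum (f 0) n) (sum (g 0) n) _ _)
  where
  lem : ∀ p q r s → p + q + (r + s) ≡ p + r + (q + s)
  lem = solve-∀ ℚ-ring

rect-* : ∀ a b m n → rect (λ i j → a i * b j) m n ≡ sum a m * sum b n
rect-* a b zero    n = sym (*-zeroˡ (sum b n))
rect-* a b (suc m) n = begin
  sum (λ j → a 0 * b j) n + rect (λ i j → a (suc i) * b j) m n   ≡⟨ cong₂ _+_ (sum-scale (a 0) b n) (rect-* (λ i → a (suc i)) b m n) ⟩
  a 0 * sum b n + sum (λ i → a (suc i)) m * sum b n              ≡⟨ *-distribʳ-+ (sum b n) (a 0) _ ⟨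
  (a 0 + sum (λ i → a (suc i)) m) * sum b n                      ≡⟨ cong (_* sum b n) (sum-suc a m) ⟨
  sum a (suc m) * sum b n                                        ∎
  where open ≡-Reasoning

tri-nonNeg : ∀ {f} → (∀ i j → 0ℚ ≤ f i j) → ∀ n → 0ℚ ≤ tri f n
tri-nonNeg 0≤f zero    = ≤-refl
tri-nonNeg 0≤f (suc n) = +-nonNeg (sum-nonNeg (0≤f 0) (suc n)) (tri-nonNeg (λ i → 0≤f (suc i)) n)

tri≤rect : ∀ {f} → (∀ i j → 0ℚ ≤ f i j) → ∀ {m n} → m ℕ.≤ n → tri f m ≤ rect f m n
tri≤rect 0≤f {zero}  _   = ≤-refl
tri≤rect 0≤f {suc m} m<n = +-mono-≤ (sum-extend (0≤f 0) m<n) (tri≤rect (λ i → 0≤f (suc i)) (ℕ.<⇒≤ m<n))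

rect≤tri : ∀ {f} → (∀ i j → 0ℚ ≤ f i j) → ∀ m n → rect f m n ≤ tri f (m ℕ.+ n)
rect≤tri 0≤f zero    n = tri-nonNeg 0≤f n
rect≤tri 0≤f (suc m) n = +-mono-≤ (sum-extend (0≤f 0) (ℕ.m≤n+m n (suc m))) (rect≤tri (λ i → 0≤f (suc i)) m n)

-- The triangle omits from the square less of f than of g, as g - f is nonnegative.
rect≤tri+corner : ∀ {f g} → (∀ i j → f i j ≤ g i j) → (∀ i j → 0ℚ ≤ g i j) → ∀ n →
  rect f n n ≤ tri f n + (tri g (n ℕ.+ n) - tri g n)
rect≤tri+corner {f} {g} f≤g 0≤g n = begin
  rect f n n                                                ≡⟨ lem₁ (rect f n n) (tri g n) (tri f n) ⟩
  tri g n - tri f n + (rect f n n + tri f n - tri g n)      ≤⟨ +-monoˡ-≤ _ (subst₂ _≤_ (tri-sub g f n) (rect-sub g f n n) (tri≤rect {λ i j → g i j - f i j} (λ i j → 0≤p-q (f≤g i j)) {n} {n} ℕ.≤-refl)) ⟩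
  rect g n n - rect f n n + (rect f n n + tri f n - tri g n) ≡⟨ lem₂ (rect g n n) (rect f n n) (tri f n) (tri g n) ⟩
  tri f n + (rect g n n - tri g n)                          ≤⟨ +-monoʳ-≤ (tri f n) (p-q≤r-q {q = tri g n} (rect≤tri 0≤g n n)) ⟩
  tri f n + (tri g (n ℕ.+ n) - tri g n)                     ∎
  where
  open ≤-Reasoning
  lem₁ : ∀ r t s → r ≡ t - s + (r + s - t)
  lem₁ = solve-∀ ℚ-ring
  lem₂ : ∀ u r s t → u - r + (r + s - t) ≡ s + (u - t)
  lem₂ = solve-∀ ℚ-ring

-- The Leibniz rule for the Euler operator; the offset a keeps track of the
-- index i through the recursion of conv.
conv-leibniz : ∀ a f {g} → (∀ i j → fromℕ (suc (a ℕ.+ i)) * f (suc i) j + fromℕ (suc j) * f i (suc j) ≡ g i j) →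
  ∀ n → fromℕ (suc (a ℕ.+ n)) * conv f (suc n) ≡ fromℕ a * f 0 (suc n) + conv g n
conv-leibniz a f {g} rule zero = begin
  fromℕ (suc (a ℕ.+ 0)) * (f 0 1 + f 1 0)                                         ≡⟨ *-distribˡ-+ w (f 0 1) (f 1 0) ⟩
  w * f 0 1 + w * f 1 0                                                           ≡⟨ cong (λ u → u * f 0 1 + w * f 1 0) w≡ ⟩
  (fromℕ a + fromℕ 1) * f 0 1 + w * f 1 0                                         ≡⟨ lem (fromℕ a) (fromℕ 1) (f 0 1) (w * f 1 0) ⟩
  fromℕ a * f 0 1 + (w * f 1 0 + fromℕ 1 * f 0 1)                                 ≡⟨ cong (fromℕ a * f 0 1 +_) (rule 0 0) ⟩
  fromℕ a * f 0 1 + g 0 0                                                         ∎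
  where
  open ≡-Reasoning
  w : ℚ
  w = fromℕ (suc (a ℕ.+ 0))
  w≡ : w ≡ fromℕ a + fromℕ 1
  w≡ = trans (fromℕ-suc (a ℕ.+ 0)) (cong (λ n → fromℕ n + 1ℚ) (ℕ.+-identityʳ a))
  lem : ∀ a u p q → (a + u) * p + q ≡ a * p + (q + u * p)
  lem = solve-∀ ℚ-ring
conv-leibniz a f {g} rule (suc n) = begin
  w * (f 0 (suc (suc n)) + C)                                                     ≡⟨ *-distribˡ-+ w _ C ⟩
  w * f 0 (suc (suc n)) + w * C                                                   ≡⟨ cong₂ _+_ (cong (_* f 0 (suc (suc n))) w≡) (trans (cong (λ m → fromℕ (suc m) * C) (ℕ.+-suc a n)) ih) ⟩
  (fromℕ a + fromℕ (suc (suc n))) * f 0 (suc (suc n)) + (fromℕ (suc a) * f 1 (suc n) + conv (λ i → g (suc i)) n)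
                                                                                  ≡⟨ lem (fromℕ a) (fromℕ (suc (suc n))) (f 0 (suc (suc n))) (fromℕ (suc a) * f 1 (suc n)) _ ⟩
  fromℕ a * f 0 (suc (suc n)) + (fromℕ (suc a) * f 1 (suc n) + fromℕ (suc (suc n)) * f 0 (suc (suc n)) + conv (λ i → g (suc i)) n)
                                                                                  ≡⟨ cong (λ u → fromℕ a * f 0 (suc (suc n)) + (u + conv (λ i → g (suc i)) n)) rule₀ ⟩
  fromℕ a * f 0 (suc (suc n)) + (g 0 (suc n) + conv (λ i → g (suc i)) n)          ∎
  where
  open ≡-Reasoning
  w C : ℚ
  w = fromℕ (suc (a ℕ.+ suc n))
  C = conv (λ i → f (suc i)) (suc n)
  w≡ : w ≡ fromℕ a + fromℕ (suc (suc n))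
  w≡ = trans (cong fromℕ (sym (ℕ.+-suc a (suc n)))) (fromℕ-+ a (suc (suc n)))
  ih : fromℕ (suc (suc a ℕ.+ n)) * C ≡ fromℕ (suc a) * f 1 (suc n) + conv (λ i → g (suc i)) n
  ih = conv-leibniz (suc a) (λ i → f (suc i)) (λ i j → trans (cong (λ m → fromℕ (suc m) * f (suc (suc i)) j + fromℕ (suc j) * f (suc i) (suc j)) (sym (ℕ.+-suc a i))) (rule (suc i) j)) n
  rule₀ : fromℕ (suc a) * f 1 (suc n) + fromℕ (suc (suc n)) * f 0 (suc (suc n)) ≡ g 0 (suc n)
  rule₀ = trans (cong (λ m → fromℕ (suc m) * f 1 (suc n) + fromℕ (suc (suc n)) * f 0 (suc (suc n))) (sym (ℕ.+-identityʳ a))) (rule 0 (suc n))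
  lem : ∀ a v p q r → (a + v) * p + (q + r) ≡ a * p + (q + v * p + r)
  lem = solve-∀ ℚ-ring

-- The Euler operator multiplies every term with i + j = n + 1 by n + 1, so `conv-leibniz` at offset
-- 0 can be divided by n + 1. With `g` a multiple of `f` this yields the binomial theorem, with `g`
-- zero the cancellation in `tri-const`.
conv-suc : ∀ f {g} → (∀ i j → fromℕ (suc i) * f (suc i) j + fromℕ (suc j) * f i (suc j) ≡ g i j) →
  ∀ n → conv f (suc n) ≡ conv g n * 1/1+ n
conv-suc f {g} rule n = begin
  conv f (suc n)                                     ≡⟨ *-identityʳ (conv f (suc n)) ⟨
  conv f (suc n) * 1ℚ                                ≡⟨ cong (conv f (suc n) *_) (fromℕ*1/ n) ⟨
  conv f (suc n) * (fromℕ (suc n) * 1/1+ n)          ≡⟨ lem (conv f (suc n)) (fromℕ (suc n)) (1/1+ n) ⟩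
  fromℕ (suc n) * conv f (suc n) * 1/1+ n            ≡⟨ cong (_* 1/1+ n) (conv-leibniz 0 f rule n) ⟩
  (fromℕ 0 * f 0 (suc n) + conv g n) * 1/1+ n        ≡⟨ cong (_* 1/1+ n) (trans (cong (_+ conv g n) (*-zeroˡ (f 0 (suc n)))) (+-identityˡ (conv g n))) ⟩
  conv g n * 1/1+ n                                  ∎
  where
  open ≡-Reasoning
  lem : ∀ c k r → c * (k * r) ≡ k * c * r
  lem = solve-∀ ℚ-ring

conv-scale : ∀ c f n → conv (λ i j → c * f i j) n ≡ c * conv f n
conv-scale c f zero    = refl
conv-scale c f (suc n) = trans (cong (c * f 0 (suc n) +_) (conv-scale c (λ i → f (suc i)) n)) (sym (*-distribˡ-+ c (f 0 (suc n)) _))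

conv-zero : ∀ n → conv (λ _ _ → 0ℚ) n ≡ 0ℚ
conv-zero zero    = refl
conv-zero (suc n) = trans (+-identityˡ _) (conv-zero n)

^/!-suc : ∀ x k → fromℕ (suc k) * x ^ suc k /! ≡ x ^ k /! * x
^/!-suc x k = trans (lem (fromℕ (suc k)) (x ^ k /! * x) (1/1+ k))
  (trans (cong (x ^ k /! * x *_) (fromℕ*1/ k)) (*-identityʳ (x ^ k /! * x)))
  where
  lem : ∀ k p r → k * (p * r) ≡ p * (k * r)
  lem = solve-∀ ℚ-ring

-- With the factorials divided out no binomial coefficients occur: both sides satisfy the same
-- recursion in `n`.
^/!-binomial : ∀ x y n → conv (λ i j → x ^ i /! * y ^ j /!) n ≡ (x + y) ^ n /!
^/!-binomial x y zero    = *-identityˡ 1ℚ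
^/!-binomial x y (suc n) = begin
  conv f (suc n)                            ≡⟨ conv-suc f rule n ⟩
  conv (λ i j → (x + y) * f i j) n * 1/1+ n ≡⟨ cong (_* 1/1+ n) (trans (conv-scale (x + y) f n) (cong ((x + y) *_) (^/!-binomial x y n))) ⟩
  (x + y) * (x + y) ^ n /! * 1/1+ n         ≡⟨ cong (_* 1/1+ n) (*-comm (x + y) ((x + y) ^ n /!)) ⟩
  (x + y) ^ n /! * (x + y) * 1/1+ n         ∎
  where
  open ≡-Reasoning
  f : ℕ → ℕ → ℚ
  f i j = x ^ i /! * y ^ j /!
  lem₁ : ∀ m n p q p′ q′ → m * (p′ * q) + n * (p * q′) ≡ m * p′ * q + p * (n * q′)
  lem₁ = solve-∀ ℚ-ring
  lem₂ : ∀ p q x y → p * x * q + p * (q * y) ≡ (x + y) * (p * q)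
  lem₂ = solve-∀ ℚ-ring
  rule : ∀ i j → fromℕ (suc i) * f (suc i) j + fromℕ (suc j) * f i (suc j) ≡ (x + y) * f i j
  rule i j = trans (lem₁ (fromℕ (suc i)) (fromℕ (suc j)) (x ^ i /!) (y ^ j /!) (x ^ suc i /!) (y ^ suc j /!))
    (trans (cong₂ (λ u v → u * y ^ j /! + x ^ i /! * v) (^/!-suc x i) (^/!-suc y j))
      (lem₂ (x ^ i /!) (y ^ j /!) x y))

-- exp, cos and sin

-1ℚ : ℚ
-1ℚ = - 1ℚ

expPartial : ℚ → ℕ → ℚ
expPartial x = sum (x ^_/!)

expSeries≡expPartial : ∀ x n → Series.partial expCoeff ∣expCoeff∣≤1 x n ≡ expPartial x n
expSeries≡expPartial x = sum-cong λ k → *-identityˡ (x ^ k /!)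

tri-^/! : ∀ κ x y n → tri (λ i j → κ * (x ^ i /! * y ^ j /!)) n ≡ κ * expPartial (x + y) n
tri-^/! κ x y n = trans (tri≡sum f n)
  (trans (sum-cong (λ k → trans (conv-scale κ (λ i j → x ^ i /! * y ^ j /!) k) (cong (κ *_) (^/!-binomial x y k))) n)
    (sum-scale κ ((x + y) ^_/!) n))
  where
  f : ℕ → ℕ → ℚ
  f i j = κ * (x ^ i /! * y ^ j /!)

expPartial-*-≤ : ∀ {x y} → 0ℚ ≤ x → 0ℚ ≤ y → ∀ m n → expPartial x m * expPartial y n ≤ expPartial (x + y) (m ℕ.+ n)
expPartial-*-≤ {x} {y} 0≤x 0≤y m n = begin
  expPartial x m * expPartial y n                  ≡⟨ rect-* (x ^_/!) (y ^_/!) m n ⟨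
  rect (λ i j → x ^ i /! * y ^ j /!) m n           ≤⟨ rect≤tri (λ i j → *-nonNeg (^/!-nonNeg 0≤x i) (^/!-nonNeg 0≤y j)) m n ⟩
  tri (λ i j → x ^ i /! * y ^ j /!) (m ℕ.+ n)      ≡⟨ trans (tri≡sum _ (m ℕ.+ n)) (sum-cong (^/!-binomial x y) (m ℕ.+ n)) ⟩
  expPartial (x + y) (m ℕ.+ n)                     ∎
  where open ≤-Reasoning

-- The hypothesis is the coefficient form of a vanishing derivative, such as that of cos² + sin² or
-- of exp x · exp (- x). It makes every antidiagonal but the zeroth sum to 0.
tri-const : ∀ f → (∀ i j → fromℕ (suc i) * f (suc i) j + fromℕ (suc j) * f i (suc j) ≡ 0ℚ) →
  ∀ n → tri f (suc n) ≡ f 0 0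
tri-const f rule zero    = trans (tri-suc f 0) (+-identityˡ (f 0 0))
tri-const f rule (suc n) = begin
  tri f (suc (suc n))               ≡⟨ tri-suc f (suc n) ⟩
  tri f (suc n) + conv f (suc n)    ≡⟨ cong₂ _+_ (tri-const f rule n) (trans (conv-suc f rule n) (trans (cong (_* 1/1+ n) (conv-zero n)) (*-zeroˡ (1/1+ n)))) ⟩
  f 0 0 + 0ℚ                        ≡⟨ +-identityʳ (f 0 0) ⟩
  f 0 0                             ∎
  where open ≡-Reasoning

-- The product of two exponential series at `fromℕ b` is the series at `b + b`, hence the parameter
-- of `ExpBounds`. The corner is at most `κ` times the tail of that series between `n` and 2n terms,
-- which decays like `1/1+ n`. `K < n` makes `n` positive, so that the triangle contains (0 , 0).
rect-const : ∀ κ b f → 0ℚ ≤ κ →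
  (∀ i j → f i j ≤ κ * (fromℕ b ^ i /! * fromℕ b ^ j /!)) →
  (∀ i j → fromℕ (suc i) * f (suc i) j + fromℕ (suc j) * f i (suc j) ≡ 0ℚ) →
  let open ExpBounds (b ℕ.+ b) in
  ∀ n → K ℕ.< n → rect f n n ≤ f 0 0 + κ * (W K + W K) * 1/1+ n
rect-const κ b f 0≤κ f≤g rule n@(suc n-1) K<n = begin
  rect f n n                                           ≤⟨ rect≤tri+corner {f} {g} f≤g (λ i j → *-nonNeg 0≤κ (*-nonNeg (^/!-nonNeg (fromℕ-nonNeg b) i) (^/!-nonNeg (fromℕ-nonNeg b) j))) n ⟩
  tri f n + (tri g (n ℕ.+ n) - tri g n)                ≡⟨ cong₂ _+_ (tri-const f rule n-1) (cong₂ _-_ (tri-g (n ℕ.+ n)) (tri-g n)) ⟩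
  f 0 0 + (κ * E (n ℕ.+ n) - κ * E n)                  ≡⟨ cong (f 0 0 +_) (lem₁ κ (E (n ℕ.+ n)) (E n)) ⟩
  f 0 0 + κ * (E (n ℕ.+ n) - E n)                      ≤⟨ +-monoʳ-≤ (f 0 0) (≤-*ˡ 0≤κ (≤-trans (E-tail K≤n (ℕ.m≤m+n n n)) (+-mono-≤ (T-decay n K≤n) (T-decay n K≤n)))) ⟩
  f 0 0 + κ * (W K * 1/1+ n + W K * 1/1+ n)            ≡⟨ cong (f 0 0 +_) (lem₂ κ (W K) (1/1+ n)) ⟩
  f 0 0 + κ * (W K + W K) * 1/1+ n                     ∎
  where
  open ExpBounds (b ℕ.+ b)
  open ≤-Reasoning
  K≤n : K ℕ.≤ n
  K≤n = ℕ.<⇒≤ K<n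
  g : ℕ → ℕ → ℚ
  g i j = κ * (fromℕ b ^ i /! * fromℕ b ^ j /!)
  tri-g : ∀ n → tri g n ≡ κ * E n
  tri-g n = trans (tri-^/! κ (fromℕ b) (fromℕ b) n) (cong (λ x → κ * expPartial x n) (sym (fromℕ-+ b b)))
  lem₁ : ∀ k p q → k * p - k * q ≡ k * (p - q)
  lem₁ = solve-∀ ℚ-ring
  lem₂ : ∀ k w r → k * (w * r + w * r) ≡ k * (w + w) * r
  lem₂ = solve-∀ ℚ-ring

≤ℝ-vanishing : ∀ {x y} D N → 0ℚ ≤ D → (∀ n → N ℕ.≤ n → seq x n ≤ seq y n + D * 1/1+ n) → x ≤ℝ y
≤ℝ-vanishing {x} {y} D N 0≤D x≤ ε 0<ε =
  let (M , le) = *1/1+-archimedean D ε 0≤D 0<ε in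
  N ℕ.+ M , λ n n≥ → ≤-trans (x≤ n (ℕ.m+n≤o⇒m≤o N n≥))
    (+-monoʳ-≤ (seq y n) (≤-trans (≤-*ˡ 0≤D (1/1+-anti (ℕ.m+n≤o⇒n≤o N n≥))) le))

*-≤-abs : ∀ {p q P Q} → ∣ p ∣ ≤ P → ∣ q ∣ ≤ Q → p * q ≤ P * Q
*-≤-abs {p} {q} {P} {Q} p≤P q≤Q = ≤-trans (p≤∣p∣ (p * q))
  (≤-trans (≤-reflexive (∣p*q∣≡∣p∣*∣q∣ p q)) (*-mono-≤′ (0≤∣p∣ q) (≤-trans (0≤∣p∣ p) p≤P) p≤P q≤Q))

cosCoeff-suc : ∀ k → cosCoeff (suc k) ≡ - sinCoeff k
cosCoeff-suc 0             = refl
cosCoeff-suc 1             = refl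
cosCoeff-suc (suc (suc k)) = cong -_ (cosCoeff-suc k)

sinCoeff-suc : ∀ k → sinCoeff (suc k) ≡ cosCoeff k
sinCoeff-suc 0             = refl
sinCoeff-suc 1             = refl
sinCoeff-suc (suc (suc k)) = cong -_ (sinCoeff-suc k)

-- `rule` is the product rule for cos² + sin² on coefficients, from cos′ = - sin and sin′ = cos. The
-- constant 2 majorises the two products in `f`, since all coefficients are at most 1 in absolute
-- value.
cos²+sin²≤1 : ∀ y → cos y *ℝ cos y +ℝ sin y *ℝ sin y ≤ℝ fromℚ 1ℚ
cos²+sin²≤1 y = let (b , y≤b) = bounded y in go b y≤b
  where
  go : ∀ b → (∀ n → ∣ seq y n ∣ ≤ fromℕ b) → cos y *ℝ cos y +ℝ sin y *ℝ sin y ≤ℝ fromℚ 1ℚ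
  go b y≤b = ≤ℝ-vanishing {cos y *ℝ cos y +ℝ sin y *ℝ sin y} {fromℚ 1ℚ} (2ℚ * (W K + W K)) (suc K)
    (*-nonNeg (nonNegative⁻¹ 2ℚ) (+-nonNeg (W-nonNeg K) (W-nonNeg K)))
    λ n K<n → subst (_≤ 1ℚ + 2ℚ * (W K + W K) * 1/1+ n) (square (seq y n) n)
      (rect-const 2ℚ b (f (seq y n)) (nonNegative⁻¹ 2ℚ) (f≤ (y≤b n)) (rule (seq y n)) n K<n)
    where
    open ExpBounds (b ℕ.+ b)
    c s : ℚ → ℕ → ℚ
    c y k = cosCoeff k * y ^ k /!
    s y k = sinCoeff k * y ^ k /!
    f : ℚ → ℕ → ℕ → ℚ
    f y i j = c y i * c y j + s y i * s y j
    square : ∀ y n → rect (f y) n n ≡ sum (c y) n * sum (c y) n + sum (s y) n * sum (s y) n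
    square y n = trans (rect-+ (λ i j → c y i * c y j) (λ i j → s y i * s y j) n n)
      (cong₂ _+_ (rect-* (c y) (c y) n n) (rect-* (s y) (s y) n n))
    f≤ : ∀ {y} → ∣ y ∣ ≤ fromℕ b → ∀ i j → f y i j ≤ 2ℚ * (fromℕ b ^ i /! * fromℕ b ^ j /!)
    f≤ {y} y≤b i j = subst (f y i j ≤_) (lem (fromℕ b ^ i /! * fromℕ b ^ j /!)) (+-mono-≤
      (*-≤-abs {c y i} {c y j} (C.∣c*∣≤ i (^/!-abs y≤b i)) (C.∣c*∣≤ j (^/!-abs y≤b j)))
      (*-≤-abs {s y i} {s y j} (S.∣c*∣≤ i (^/!-abs y≤b i)) (S.∣c*∣≤ j (^/!-abs y≤b j))))
      where
      module C = Series cosCoeff ∣cosCoeff∣≤1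
      module S = Series sinCoeff ∣sinCoeff∣≤1
      lem : ∀ x → x + x ≡ 2ℚ * x
      lem x = trans (cong₂ _+_ (sym (*-identityˡ x)) (sym (*-identityˡ x))) (sym (*-distribʳ-+ x 1ℚ 1ℚ))
    scale : ∀ k a p′ p y → k * p′ ≡ p * y → k * (a * p′) ≡ a * p * y
    scale k a p′ p y eq = trans (lem₁ k a p′) (trans (cong (a *_) eq) (sym (*-assoc a p y)))
      where
      lem₁ : ∀ k a p → k * (a * p) ≡ a * (k * p)
      lem₁ = solve-∀ ℚ-ring
    c-suc : ∀ y k → fromℕ (suc k) * c y (suc k) ≡ - s y k * y
    c-suc y k = trans (scale (fromℕ (suc k)) (cosCoeff (suc k)) (y ^ suc k /!) (y ^ k /!) y (^/!-suc y k))
      (cong (_* y) (trans (cong (_* y ^ k /!) (cosCoeff-suc k)) (sym (neg-distribˡ-* (sinCoeff k) (y ^ k /!)))))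
    s-suc : ∀ y k → fromℕ (suc k) * s y (suc k) ≡ c y k * y
    s-suc y k = trans (scale (fromℕ (suc k)) (sinCoeff (suc k)) (y ^ suc k /!) (y ^ k /!) y (^/!-suc y k))
      (cong (λ a → a * y ^ k /! * y) (sinCoeff-suc k))
    lem₂ : ∀ m n ci cj si sj ci′ cj′ si′ sj′ → m * (ci′ * cj + si′ * sj) + n * (ci * cj′ + si * sj′)
      ≡ (m * ci′) * cj + (m * si′) * sj + (ci * (n * cj′) + si * (n * sj′))
    lem₂ = solve-∀ ℚ-ring
    lem₃ : ∀ ci cj si sj y → (- si * y) * cj + (ci * y) * sj + (ci * (- sj * y) + si * (cj * y)) ≡ 0ℚ
    lem₃ = solve-∀ ℚ-ring
    rule : ∀ y i j → fromℕ (suc i) * f y (suc i) j + fromℕ (suc j) * f y i (suc j) ≡ 0ℚ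
    rule y i j = trans (lem₂ (fromℕ (suc i)) (fromℕ (suc j)) (c y i) (c y j) (s y i) (s y j) _ _ _ _)
      (trans (cong₂ _+_
        (cong₂ (λ u v → u * c y j + v * s y j) (c-suc y i) (s-suc y i))
        (cong₂ (λ u v → c y i * u + s y i * v) (c-suc y j) (s-suc y j)))
        (lem₃ (c y i) (c y j) (s y i) (s y j) y))

-- `rect-const` bounds only from above; the factor `s`, taken as 1 and as -1, extracts both an upper
-- and a lower bound for the product.
exp-neg : ∀ s → ∣ s ∣ ≤ 1ℚ → ∀ x → fromℚ s *ℝ (exp x *ℝ exp (-ℝ x)) ≤ℝ fromℚ s
exp-neg s ∣s∣≤1 x = let (b , x≤b) = bounded x in go b x≤b
  where
  go : ∀ b → (∀ n → ∣ seq x n ∣ ≤ fromℕ b) → fromℚ s *ℝ (exp x *ℝ exp (-ℝ x)) ≤ℝ fromℚ s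
  go b x≤b = ≤ℝ-vanishing {fromℚ s *ℝ (exp x *ℝ exp (-ℝ x))} {fromℚ s} (1ℚ * (W K + W K)) (suc K)
    (*-nonNeg (<⇒≤ 0<1ℚ) (+-nonNeg (W-nonNeg K) (W-nonNeg K)))
    λ n K<n → subst₂ _≤_ (square (seq x n) n) (cong (_+ 1ℚ * (W K + W K) * 1/1+ n) (trans (*-identityʳ (s * 1ℚ)) (*-identityʳ s)))
      (rect-const 1ℚ b (f (seq x n)) (<⇒≤ 0<1ℚ) (f≤ (x≤b n)) (rule (seq x n)) n K<n)
    where
    open ExpBounds (b ℕ.+ b)
    f : ℚ → ℕ → ℕ → ℚ
    f x i j = (s * x ^ i /!) * (- x) ^ j /!
    square : ∀ x n → rect (f x) n n ≡ s * (Series.partial expCoeff ∣expCoeff∣≤1 x n * Series.partial expCoeff ∣expCoeff∣≤1 (- x) n)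
    square x n = trans (rect-* (λ i → s * x ^ i /!) ((- x) ^_/!) n n)
      (trans (cong (_* expPartial (- x) n) (sum-scale s (x ^_/!) n))
      (trans (*-assoc s (expPartial x n) (expPartial (- x) n))
        (cong (s *_) (sym (cong₂ _*_ (expSeries≡expPartial x n) (expSeries≡expPartial (- x) n))))))
    f≤ : ∀ {x} → ∣ x ∣ ≤ fromℕ b → ∀ i j → f x i j ≤ 1ℚ * (fromℕ b ^ i /! * fromℕ b ^ j /!)
    f≤ {x} x≤b i j = subst (f x i j ≤_) (sym (*-identityˡ _)) (*-≤-abs {s * x ^ i /!} {(- x) ^ j /!}
      (Series.∣c*∣≤ (λ _ → s) (λ _ → ∣s∣≤1) 0 (^/!-abs x≤b i))
      (^/!-abs (subst (_≤ fromℕ b) (sym (∣-p∣≡∣p∣ x)) x≤b) j))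
    lem₁ : ∀ s m n p q p′ q′ → m * (s * p′ * q) + n * (s * p * q′) ≡ s * (m * p′ * q + p * (n * q′))
    lem₁ = solve-∀ ℚ-ring
    lem₂ : ∀ s p q x → s * (p * x * q + p * (q * - x)) ≡ 0ℚ
    lem₂ = solve-∀ ℚ-ring
    rule : ∀ x i j → fromℕ (suc i) * f x (suc i) j + fromℕ (suc j) * f x i (suc j) ≡ 0ℚ
    rule x i j = trans (lem₁ s (fromℕ (suc i)) (fromℕ (suc j)) (x ^ i /!) ((- x) ^ j /!) (x ^ suc i /!) ((- x) ^ suc j /!))
      (trans (cong₂ (λ u v → s * (u * (- x) ^ j /! + x ^ i /! * v)) (^/!-suc x i) (^/!-suc (- x) j))
        (lem₂ s (x ^ i /!) ((- x) ^ j /!) x))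

-- The growth of exp (ln n)

-- Dividing by `D + 1` instead of `D` covers the case D = 0.
shrink : ∀ D c ε → 0ℚ ≤ D → 0ℚ < c → 0ℚ < ε → ∃[ δ ] 0ℚ < δ × δ ≤ c × D * δ ≤ ε
shrink D c ε 0≤D 0<c 0<ε with split (D + 1ℚ) ε (<-≤-trans 0<1ℚ (q≤+q 0≤D)) 0<ε
... | δ , 0<δ , eq = δ ⊓ c , 0<δ⊓c , p⊓q≤q δ c , (begin
  D * (δ ⊓ c)   ≤⟨ ≤-*ˡ 0≤D (p⊓q≤p δ c) ⟩
  D * δ         ≤⟨ ≤-*ʳ {δ} {D} {D + 1ℚ} (<⇒≤ 0<δ) (p≤p+ (<⇒≤ 0<1ℚ)) ⟩
  (D + 1ℚ) * δ  ≡⟨ eq ⟩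
  ε             ∎)
  where
  open ≤-Reasoning
  0<δ⊓c : 0ℚ < δ ⊓ c
  0<δ⊓c with ⊓-sel δ c
  ... | inj₁ eq = subst (0ℚ <_) (sym eq) 0<δ
  ... | inj₂ eq = subst (0ℚ <_) (sym eq) 0<c

≤ℝ-trans : ∀ {x y z} → x ≤ℝ y → y ≤ℝ z → x ≤ℝ z
≤ℝ-trans {x} {y} {z} x≤y y≤z ε 0<ε =
  let (M , M≤) = x≤y (½ * ε) (half-pos 0<ε)
      (N , N≤) = y≤z (½ * ε) (half-pos 0<ε)
  in M ℕ.+ N , λ n n≥ → begin
    seq x n                        ≤⟨ M≤ n (ℕ.m+n≤o⇒m≤o M n≥) ⟩
    seq y n + ½ * ε                ≤⟨ +-monoˡ-≤ (½ * ε) (N≤ n (ℕ.m+n≤o⇒n≤o M n≥)) ⟩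
    seq z n + ½ * ε + ½ * ε        ≡⟨ +-assoc (seq z n) (½ * ε) (½ * ε) ⟩
    seq z n + (½ * ε + ½ * ε)      ≡⟨ cong (seq z n +_) (halves ε) ⟩
    seq z n + ε                    ∎
  where open ≤-Reasoning

pointwise-≤ℝ : ∀ {x y} → (∀ n → seq x n ≤ seq y n) → x ≤ℝ y
pointwise-≤ℝ x≤y ε 0<ε = 0 , λ n _ → ≤-trans (x≤y n) (p≤p+ (<⇒≤ 0<ε))

*ℝ-monoˡ-≤ : ∀ {x y z} → (∀ n → 0ℚ ≤ seq x n) → y ≤ℝ z → x *ℝ y ≤ℝ x *ℝ z
*ℝ-monoˡ-≤ {x} {y} {z} 0≤x y≤z ε 0<ε =
  let (b , x≤b) = bounded x
      (δ , 0<δ , _ , bδ≤ε) = shrink (fromℕ b) 1ℚ ε (fromℕ-nonNeg b) 0<1ℚ 0<ε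
      (N , N≤) = y≤z δ 0<δ
  in N , λ n N≤n → begin
    seq x n * seq y n                   ≤⟨ ≤-*ˡ (0≤x n) (N≤ n N≤n) ⟩
    seq x n * (seq z n + δ)             ≡⟨ *-distribˡ-+ (seq x n) (seq z n) δ ⟩
    seq x n * seq z n + seq x n * δ     ≤⟨ +-monoʳ-≤ (seq x n * seq z n) (≤-trans (≤-*ʳ (<⇒≤ 0<δ) (≤-trans (p≤∣p∣ (seq x n)) (x≤b n))) bδ≤ε) ⟩
    seq x n * seq z n + ε               ∎
  where open ≤-Reasoning

expPartial-nonNeg : ∀ {x} → 0ℚ ≤ x → ∀ n → 0ℚ ≤ expPartial x n
expPartial-nonNeg 0≤x = sum-nonNeg (^/!-nonNeg 0≤x)

exp-nonNeg : ∀ {x} → (∀ n → 0ℚ ≤ seq x n) → ∀ n → 0ℚ ≤ seq (exp x) n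
exp-nonNeg {x} 0≤x n = subst (0ℚ ≤_) (sym (expSeries≡expPartial (seq x n) n)) (expPartial-nonNeg (0≤x n) n)

-- Multiplying partial sums changes their length. This returns from any length `m` to the length `n`
-- that the diagonal sequence of `exp` has at index `n`.
expPartial-tail : ∀ b {x} → 0ℚ ≤ x → x ≤ fromℕ b → let open ExpBounds b in
  ∀ m n → K ℕ.≤ n → expPartial x m ≤ expPartial x n + (W K + W K) * 1/1+ n
expPartial-tail b {x} 0≤x x≤b m n K≤n with ℕ.≤-total m n
... | inj₁ m≤n = ≤-trans (sum-extend (^/!-nonNeg 0≤x) m≤n) (p≤p+ (*-nonNeg (+-nonNeg (W-nonNeg K) (W-nonNeg K)) (1/1+-nonNeg n)))
  where open ExpBounds b
... | inj₂ n≤m = begin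
  expPartial x m                                            ≤⟨ p≤q+∣p-q∣ (expPartial x m) (expPartial x n) ⟩
  expPartial x n + ∣ expPartial x m - expPartial x n ∣      ≡⟨ cong₂ (λ p q → expPartial x n + ∣ p - q ∣) (expSeries≡expPartial x m) (expSeries≡expPartial x n) ⟨
  expPartial x n + ∣ S.partial x m - S.partial x n ∣        ≤⟨ +-monoʳ-≤ (expPartial x n) (≤-trans (S.partial-tail b ∣x∣≤b m n≤m) (≤-trans (E-tail K≤n n≤m) (+-mono-≤ (T-decay n K≤n) (T-decay n K≤n)))) ⟩
  expPartial x n + (W K * 1/1+ n + W K * 1/1+ n)            ≡⟨ cong (expPartial x n +_) (*-distribʳ-+ (1/1+ n) (W K) (W K)) ⟨
  expPartial x n + (W K + W K) * 1/1+ n                     ∎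
  where
  open ExpBounds b
  open ≤-Reasoning
  module S = Series expCoeff ∣expCoeff∣≤1
  ∣x∣≤b : ∣ x ∣ ≤ fromℕ b
  ∣x∣≤b = subst (_≤ fromℕ b) (sym (0≤p⇒∣p∣≡p 0≤x)) x≤b

-- For nonnegative terms the square i, j < n lies in the triangle i + j < 2n, which sums to the
-- partial sum at 2x with 2n terms. Writing 2x as a product prepares for replacing 2 by `σ`.
exp-square-≤ : ∀ {x} → (∀ n → 0ℚ ≤ seq x n) → exp x *ℝ exp x ≤ℝ exp (x *ℝ fromℚ 2ℚ)
exp-square-≤ {x} 0≤x = let (b , x2≤b) = bounded (x *ℝ fromℚ 2ℚ) in
  let open ExpBounds b in
  ≤ℝ-vanishing {exp x *ℝ exp x} {exp (x *ℝ fromℚ 2ℚ)} (W K + W K) K (+-nonNeg (W-nonNeg K) (W-nonNeg K)) λ n K≤n → begin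
    seq (exp x) n * seq (exp x) n                                   ≡⟨ cong₂ _*_ (expSeries≡expPartial (seq x n) n) (expSeries≡expPartial (seq x n) n) ⟩
    expPartial (seq x n) n * expPartial (seq x n) n                 ≤⟨ expPartial-*-≤ (0≤x n) (0≤x n) n n ⟩
    expPartial (seq x n + seq x n) (n ℕ.+ n)                        ≡⟨ cong (λ y → expPartial y (n ℕ.+ n)) (double (seq x n)) ⟩
    expPartial (seq x n * 2ℚ) (n ℕ.+ n)                             ≤⟨ expPartial-tail b (*-nonNeg (0≤x n) (nonNegative⁻¹ 2ℚ)) (≤-trans (p≤∣p∣ (seq x n * 2ℚ)) (x2≤b n)) (n ℕ.+ n) n K≤n ⟩
    expPartial (seq x n * 2ℚ) n + (W K + W K) * 1/1+ n              ≡⟨ cong (_+ (W K + W K) * 1/1+ n) (expSeries≡expPartial (seq x n * 2ℚ) n) ⟨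
    seq (exp (x *ℝ fromℚ 2ℚ)) n + (W K + W K) * 1/1+ n              ∎
  where
  open ≤-Reasoning
  double : ∀ x → x + x ≡ x * 2ℚ
  double x = trans (cong₂ _+_ (sym (*-identityʳ x)) (sym (*-identityʳ x))) (sym (*-distribˡ-+ x 1ℚ 1ℚ))

-- At index `n` only `xn ≤ yn + δ` is known. Termwise comparison, with `xn` nonnegative, gives the
-- bound at `yn + δ`, and the Lipschitz constant `Φ K` moves it to `yn`. The bound `suc b` leaves
-- room for δ ≤ 1.
exp-mono-≤ : ∀ {x y} → (∀ n → 0ℚ ≤ seq x n) → x ≤ℝ y → exp x ≤ℝ exp y
exp-mono-≤ {x} {y} 0≤x x≤y ε 0<ε =
  let (b , y≤b) = bounded y
      open ExpBounds (suc b)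
      0≤Φ = E-bound 0
      (δ , 0<δ , δ≤1 , Φδ≤ε) = shrink (Φ K) 1ℚ ε 0≤Φ 0<1ℚ 0<ε
      (N , N≤) = x≤y δ 0<δ
  in N , λ n N≤n →
    let xn = seq x n
        yn = seq y n
        b≤ : fromℕ b + δ ≤ fromℕ (suc b)
        b≤ = ≤-trans (+-monoʳ-≤ (fromℕ b) δ≤1) (≤-reflexive (sym (fromℕ-suc b)))
        y+δ≤ : ∣ yn + δ ∣ ≤ fromℕ (suc b)
        y+δ≤ = ≤-trans (∣p+q∣≤∣p∣+∣q∣ yn δ) (≤-trans (+-mono-≤ (y≤b n) (≤-reflexive (0≤p⇒∣p∣≡p (<⇒≤ 0<δ)))) b≤)
        y≤ : ∣ yn ∣ ≤ fromℕ (suc b)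
        y≤ = ≤-trans (y≤b n) (≤-trans (p≤p+ (<⇒≤ 0<δ)) b≤)
    in begin
      seq (exp x) n                                                     ≡⟨ expSeries≡expPartial xn n ⟩
      expPartial xn n                                                   ≤⟨ sum-mono (λ k → ≤-trans (p≤∣p∣ (xn ^ k /!)) (^/!-abs (subst (_≤ yn + δ) (sym (0≤p⇒∣p∣≡p (0≤x n))) (N≤ n N≤n)) k)) n ⟩
      expPartial (yn + δ) n                                             ≡⟨ expSeries≡expPartial (yn + δ) n ⟨
      S.partial (yn + δ) n                                              ≤⟨ p≤q+∣p-q∣ (S.partial (yn + δ) n) (S.partial yn n) ⟩
      S.partial yn n + ∣ S.partial (yn + δ) n - S.partial yn n ∣        ≤⟨ +-monoʳ-≤ (S.partial yn n) (≤-trans (S.partial-lipschitz (suc b) y+δ≤ y≤ n) (begin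
        ∣ yn + δ - yn ∣ * S.D (suc b) n                                   ≡⟨ cong (_* S.D (suc b) n) (trans (cong ∣_∣ (lem yn δ)) (0≤p⇒∣p∣≡p (<⇒≤ 0<δ))) ⟩
        δ * S.D (suc b) n                                                 ≤⟨ ≤-*ˡ (<⇒≤ 0<δ) (S.D≤ (suc b) n) ⟩
        δ * Φ K                                                           ≡⟨ *-comm δ (Φ K) ⟩
        Φ K * δ                                                           ≤⟨ Φδ≤ε ⟩
        ε                                                                 ∎)) ⟩
      S.partial yn n + ε                                                ∎
  where
  open ≤-Reasoning
  module S = Series expCoeff ∣expCoeff∣≤1
  lem : ∀ y d → y + d - y ≡ d
  lem = solve-∀ ℚ-ring

-- exp dominates the product of the 1 + 1/i over K < i ≤ K + j, which telescopes.
expPartial-H : ∀ K j → fromℕ (suc (K ℕ.+ j)) * 1/1+ K ≤ expPartial (H (K ℕ.+ j) - H K) (suc (j ℕ.* 2))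
expPartial-H K zero    = ≤-reflexive (trans (cong (λ k → fromℕ (suc k) * 1/1+ K) (ℕ.+-identityʳ K)) (fromℕ*1/ K))
expPartial-H K (suc j) = begin
  fromℕ (suc (K ℕ.+ suc j)) * 1/1+ K                                ≡⟨ cong (λ k → fromℕ (suc k) * 1/1+ K) (ℕ.+-suc K j) ⟩
  fromℕ (suc (suc (K ℕ.+ j))) * 1/1+ K                              ≡⟨ cong (_* 1/1+ K) (trans (fromℕ-suc (suc (K ℕ.+ j))) (cong (v +_) (sym (fromℕ*1/ (K ℕ.+ j))))) ⟩
  (v + v * h) * 1/1+ K                                              ≡⟨ lem₁ v h (1/1+ K) ⟩
  (1ℚ + h) * (v * 1/1+ K)                                           ≤⟨ ≤-*ˡ (+-nonNeg (<⇒≤ 0<1ℚ) 0≤h) (expPartial-H K j) ⟩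
  (1ℚ + h) * expPartial x (suc (j ℕ.* 2))                           ≡⟨ cong (_* expPartial x (suc (j ℕ.* 2))) (lem₂ h) ⟨
  -- `1 + h` is the exponential sum with two terms, and lengths add under multiplication: this is
  -- the origin of the length `suc (j * 2)`.
  expPartial h 2 * expPartial x (suc (j ℕ.* 2))                     ≤⟨ expPartial-*-≤ 0≤h (0≤p-q (sum-extend 1/1+-nonNeg (ℕ.m≤m+n K j))) 2 (suc (j ℕ.* 2)) ⟩
  expPartial (h + x) (suc (suc j ℕ.* 2))                            ≡⟨ cong (λ y → expPartial y (suc (suc j ℕ.* 2))) (trans (lem₃ h (H (K ℕ.+ j)) (H K)) (cong (λ k → H k - H K) (sym (ℕ.+-suc K j)))) ⟩
  expPartial (H (K ℕ.+ suc j) - H K) (suc (suc j ℕ.* 2))            ∎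
  where
  open ≤-Reasoning
  v h x : ℚ
  v = fromℕ (suc (K ℕ.+ j))
  h = 1/1+ (K ℕ.+ j)
  x = H (K ℕ.+ j) - H K
  0≤h : 0ℚ ≤ h
  0≤h = 1/1+-nonNeg (K ℕ.+ j)
  lem₁ : ∀ v h r → (v + v * h) * r ≡ (1ℚ + h) * (v * r)
  lem₁ = solve-∀ ℚ-ring
  lem₂ : ∀ h → 0ℚ + 1ℚ + 1ℚ * h * 1ℚ ≡ 1ℚ + h
  lem₂ = solve-∀ ℚ-ring
  lem₃ : ∀ h p q → h + (p - q) ≡ p + h - q
  lem₃ = solve-∀ ℚ-ring

lnApprox-nonNeg : ∀ p k → 0ℚ ≤ lnApprox (suc p) k
lnApprox-nonNeg p k = 0≤p-q (sum-extend 1/1+-nonNeg (ℕ.m≤m+n (suc k) (p ℕ.* suc k)))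

-- With K = k + 1 and m = (p + 1) K, the telescoped product is (m + 1)/(K + 1), which falls short of
-- p + 1 by at most (p + 1)/(K + 1). This deficit and the tail of the exponential series both vanish
-- like `1/1+ k`.
fromℕ≤exp-ln : ∀ p → fromℚ (fromℕ (suc p)) ≤ℝ exp (ln (suc p))
fromℕ≤exp-ln p = let (b , x≤b) = bounded (ln (suc p)) in
  let open ExpBounds b in
  ≤ℝ-vanishing {fromℚ (fromℕ (suc p))} {exp (ln (suc p))} (W K + W K + fromℕ (suc p)) K (+-nonNeg (+-nonNeg (W-nonNeg K) (W-nonNeg K)) (fromℕ-nonNeg (suc p))) λ k K≤k →
    let x = lnApprox (suc p) k
        m = suc p ℕ.* suc k
    in begin
    N                                                                   ≡⟨ *-identityʳ N ⟨
    N * 1ℚ                                                              ≡⟨ cong (N *_) (fromℕ*1/ (suc k)) ⟨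
    N * (fromℕ (suc (suc k)) * 1/1+ (suc k))                            ≡⟨ cong (λ y → N * (y * 1/1+ (suc k))) (fromℕ-suc (suc k)) ⟩
    N * ((fromℕ (suc k) + 1ℚ) * 1/1+ (suc k))                           ≡⟨ lem N (fromℕ (suc k)) (1/1+ (suc k)) ⟩
    N * fromℕ (suc k) * 1/1+ (suc k) + N * 1/1+ (suc k)                 ≡⟨ cong (λ y → y * 1/1+ (suc k) + N * 1/1+ (suc k)) (fromℕ-* (suc p) (suc k)) ⟨
    fromℕ m * 1/1+ (suc k) + N * 1/1+ (suc k)                           ≤⟨ +-mono-≤
      (≤-*ʳ (1/1+-nonNeg (suc k)) (fromℕ-mono-≤ (ℕ.n≤1+n m)))
      (≤-*ˡ (fromℕ-nonNeg (suc p)) (1/1+-anti (ℕ.n≤1+n k))) ⟩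
    fromℕ (suc m) * 1/1+ (suc k) + N * 1/1+ k                           ≤⟨ +-monoˡ-≤ (N * 1/1+ k) (≤-trans (expPartial-H (suc k) (p ℕ.* suc k))
      (expPartial-tail b (lnApprox-nonNeg p k) (≤-trans (p≤∣p∣ x) (x≤b k)) (suc (p ℕ.* suc k ℕ.* 2)) k K≤k)) ⟩
    expPartial x k + (W K + W K) * 1/1+ k + N * 1/1+ k                  ≡⟨ lem′ (expPartial x k) (W K + W K) (1/1+ k) N ⟩
    expPartial x k + (W K + W K + N) * 1/1+ k                           ≡⟨ cong (_+ (W K + W K + N) * 1/1+ k) (expSeries≡expPartial x k) ⟨
    seq (exp (ln (suc p))) k + (W K + W K + N) * 1/1+ k                 ∎
  where
  open ≤-Reasoning
  N : ℚ
  N = fromℕ (suc p)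
  lem : ∀ n k r → n * ((k + 1ℚ) * r) ≡ n * k * r + n * r
  lem = solve-∀ ℚ-ring
  lem′ : ∀ e w r n → e + w * r + n * r ≡ e + (w + n) * r
  lem′ = solve-∀ ℚ-ring

-- Squaring n ≤ exp (ln n) settles the exponent 2; the real exponent `σ` then enters through
-- monotonicity alone, as ln n is nonnegative.
fromℕ²≤exp-ln* : ∀ p {σ} → fromℚ 2ℚ ≤ℝ σ → fromℚ (fromℕ (suc p) * fromℕ (suc p)) ≤ℝ exp (ln (suc p) *ℝ σ)
fromℕ²≤exp-ln* p {σ} 2≤σ =
  ≤ℝ-trans {N *ℝ N} {N *ℝ E} {exp (L *ℝ σ)} (*ℝ-monoˡ-≤ {N} {N} {E} (λ _ → fromℕ-nonNeg (suc p)) N≤E)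
  (≤ℝ-trans {N *ℝ E} {E *ℝ N} {exp (L *ℝ σ)} (pointwise-≤ℝ {N *ℝ E} {E *ℝ N} (λ n → ≤-reflexive (*-comm (fromℕ (suc p)) (seq E n))))
  (≤ℝ-trans {E *ℝ N} {E *ℝ E} {exp (L *ℝ σ)} (*ℝ-monoˡ-≤ {E} {N} {E} (exp-nonNeg {L} (lnApprox-nonNeg p)) N≤E)
  (≤ℝ-trans {E *ℝ E} {exp (L *ℝ fromℚ 2ℚ)} {exp (L *ℝ σ)} (exp-square-≤ {L} (lnApprox-nonNeg p))
    (exp-mono-≤ {L *ℝ fromℚ 2ℚ} {L *ℝ σ} (λ n → *-nonNeg (lnApprox-nonNeg p n) (nonNegative⁻¹ 2ℚ))
      (*ℝ-monoˡ-≤ {L} {fromℚ 2ℚ} {σ} (lnApprox-nonNeg p) 2≤σ)))))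
  where
  N L E : ℝ
  N = fromℚ (fromℕ (suc p))
  L = ln (suc p)
  E = exp L
  N≤E : N ≤ℝ E
  N≤E = fromℕ≤exp-ln p

-- Moduli of complex numbers

square-nonNeg : ∀ p → 0ℚ ≤ p * p
square-nonNeg p with ≤-total 0ℚ p
... | inj₁ 0≤p = *-nonNeg 0≤p 0≤p
... | inj₂ p≤0 = subst (0ℚ ≤_) (lem p) (*-nonNeg (neg-antimono-≤ p≤0) (neg-antimono-≤ p≤0))
  where
  lem : ∀ p → (- p) * (- p) ≡ p * p
  lem = solve-∀ ℚ-ring

square-mono-≤ : ∀ {p q} → 0ℚ ≤ p → p ≤ q → p * p ≤ q * q
square-mono-≤ 0≤p p≤q = *-mono-≤′ 0≤p (≤-trans 0≤p p≤q) p≤q p≤q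

square-cancel-≤ : ∀ {p q} → 0ℚ ≤ q → p * p ≤ q * q → p ≤ q
square-cancel-≤ {p} {q} 0≤q p²≤q² = ≮⇒≥ λ q<p → <-irrefl refl (begin-strict
  q * q   ≤⟨ ≤-*ˡ 0≤q (<⇒≤ q<p) ⟩
  q * p   <⟨ *-monoˡ-<-pos p {{positive (≤-<-trans 0≤q q<p)}} q<p ⟩
  p * p   ≤⟨ p²≤q² ⟩
  q * q   ∎)
  where open ≤-Reasoning

normSq : ℚ → ℚ → ℚ
normSq a b = a * a + b * b

normSq-triangle : ∀ {a b c d r s} → 0ℚ ≤ r → 0ℚ ≤ s → normSq a b ≤ r * r → normSq c d ≤ s * s →
  normSq (a + c) (b + d) ≤ (r + s) * (r + s)
normSq-triangle {a} {b} {c} {d} {r} {s} 0≤r 0≤s ab≤ cd≤ = begin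
  normSq (a + c) (b + d)                                        ≡⟨ lem₁ a b c d ⟩
  normSq a b + normSq c d + (a * c + b * d + (a * c + b * d))   ≤⟨ +-mono-≤ (+-mono-≤ ab≤ cd≤) (+-mono-≤ inner inner) ⟩
  r * r + s * s + (r * s + r * s)                               ≡⟨ lem₂ r s ⟩
  (r + s) * (r + s)                                             ∎
  where
  open ≤-Reasoning
  lem₁ : ∀ a b c d → (a + c) * (a + c) + (b + d) * (b + d) ≡ a * a + b * b + (c * c + d * d) + (a * c + b * d + (a * c + b * d))
  lem₁ = solve-∀ ℚ-ring
  lem₂ : ∀ r s → r * r + s * s + (r * s + r * s) ≡ (r + s) * (r + s)
  lem₂ = solve-∀ ℚ-ring
  lem₃ : ∀ a b c d → (a * c + b * d) * (a * c + b * d) + (a * d - b * c) * (a * d - b * c) ≡ (a * a + b * b) * (c * c + d * d)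
  lem₃ = solve-∀ ℚ-ring
  lem₄ : ∀ r s → r * r * (s * s) ≡ r * s * (r * s)
  lem₄ = solve-∀ ℚ-ring
  -- The Cauchy-Schwarz inequality, from Lagrange's identity `lem₃`.
  inner : a * c + b * d ≤ r * s
  inner = square-cancel-≤ (*-nonNeg 0≤r 0≤s) (begin
    (a * c + b * d) * (a * c + b * d)                                                ≤⟨ p≤p+ (square-nonNeg (a * d - b * c)) ⟩
    (a * c + b * d) * (a * c + b * d) + (a * d - b * c) * (a * d - b * c)            ≡⟨ lem₃ a b c d ⟩
    normSq a b * normSq c d                                                          ≤⟨ *-mono-≤′ (+-nonNeg (square-nonNeg c) (square-nonNeg d)) (square-nonNeg r) ab≤ cd≤ ⟩
    r * r * (s * s)                                                                  ≡⟨ lem₄ r s ⟩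
    r * s * (r * s)                                                                  ∎)

normSq⇒∣∣ˡ : ∀ {a b r} → 0ℚ ≤ r → normSq a b ≤ r * r → ∣ a ∣ ≤ r
normSq⇒∣∣ˡ {a} {b} {r} 0≤r le = ∣∣-≤ (square-cancel-≤ 0≤r a²≤) (square-cancel-≤ 0≤r (subst (_≤ r * r) (lem a) a²≤))
  where
  a²≤ : a * a ≤ r * r
  a²≤ = ≤-trans (p≤p+ (square-nonNeg b)) le
  lem : ∀ p → p * p ≡ (- p) * (- p)
  lem = solve-∀ ℚ-ring

∣∣⇒normSq : ∀ {a b r} → ∣ a ∣ ≤ r → ∣ b ∣ ≤ r → normSq a b ≤ (r + r) * (r + r)
∣∣⇒normSq {a} {b} {r} a≤r b≤r = begin
  a * a + b * b                               ≤⟨ +-mono-≤ (*-≤-abs {a} {a} a≤r a≤r) (*-≤-abs {b} {b} b≤r b≤r) ⟩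
  r * r + r * r                               ≤⟨ p≤p+ (+-nonNeg (square-nonNeg r) (square-nonNeg r)) ⟩
  r * r + r * r + (r * r + r * r)             ≡⟨ lem r ⟩
  (r + r) * (r + r)                           ∎
  where
  open ≤-Reasoning
  lem : ∀ r → r * r + r * r + (r * r + r * r) ≡ (r + r) * (r + r)
  lem = solve-∀ ℚ-ring

infix 4 ∥_∥≲_

-- For `r` nonnegative this is the non-strict bound of the modulus by `r`, squared so that triangle
-- inequality and products stay polynomial over the rationals.
∥_∥≲_ : ℂ → ℚ → Set
∥ z ∥≲ r = ∀ ε → 0ℚ < ε → ∃[ N ] ∀ n → N ℕ.≤ n → normSq (seq (re z) n) (seq (im z) n) ≤ (r + ε) * (r + ε)

∥∥≲-triangle : ∀ {z u v r s} → 0ℚ ≤ r → 0ℚ ≤ s →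
  (∀ n → seq (re z) n ≡ seq (re u) n + seq (re v) n) → (∀ n → seq (im z) n ≡ seq (im u) n + seq (im v) n) →
  ∥ u ∥≲ r → ∥ v ∥≲ s → ∥ z ∥≲ r + s
∥∥≲-triangle {z} {u} {v} {r} {s} 0≤r 0≤s re≡ im≡ u≲r v≲s ε 0<ε =
  let η = ½ * ε
      0<η = half-pos 0<ε
      (M , M≤) = u≲r η 0<η
      (N , N≤) = v≲s η 0<η
  in M ℕ.+ N , λ n n≥ → subst₂ _≤_
    (sym (cong₂ normSq (re≡ n) (im≡ n)))
    (cong (λ x → x * x) (trans (lem r s η) (cong (r + s +_) (halves ε))))
    (normSq-triangle {seq (re u) n} {seq (im u) n} (+-nonNeg 0≤r (<⇒≤ 0<η)) (+-nonNeg 0≤s (<⇒≤ 0<η))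
      (M≤ n (ℕ.m+n≤o⇒m≤o M n≥)) (N≤ n (ℕ.m+n≤o⇒n≤o M n≥)))
  where
  lem : ∀ r s h → r + h + (s + h) ≡ r + s + (h + h)
  lem = solve-∀ ℚ-ring

∥∥≲-mono : ∀ {z r s} → 0ℚ ≤ r → r ≤ s → ∥ z ∥≲ r → ∥ z ∥≲ s
∥∥≲-mono 0≤r r≤s z≲r ε 0<ε =
  let (N , N≤) = z≲r ε 0<ε
  in N , λ n N≤n → ≤-trans (N≤ n N≤n) (square-mono-≤ (+-nonNeg 0≤r (<⇒≤ 0<ε)) (+-monoˡ-≤ ε r≤s))

∥∥≲-sym : ∀ {u v r} → ∥ u -ℂ v ∥≲ r → ∥ v -ℂ u ∥≲ r
∥∥≲-sym {u} {v} {r} le ε 0<ε =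
  let (N , N≤) = le ε 0<ε
  in N , λ n N≤n → subst (_≤ (r + ε) * (r + ε)) (lem (seq (re u) n) (seq (re v) n) (seq (im u) n) (seq (im v) n)) (N≤ n N≤n)
  where
  lem : ∀ a c b d → (a - c) * (a - c) + (b - d) * (b - d) ≡ (c - a) * (c - a) + (d - b) * (d - b)
  lem = solve-∀ ℚ-ring

normSq-⊔ : ∀ a b → 0ℚ ⊔ normSq a b ≡ normSq a b
normSq-⊔ a b = p≤q⇒p⊔q≡q (+-nonNeg (square-nonNeg a) (square-nonNeg b))

∥∥≲⇒∣∣ℂ< : ∀ {z r q} → 0ℚ ≤ r → r < q → ∥ z ∥≲ r → ∣ z ∣ℂ <ℝ fromℚ q
∥∥≲⇒∣∣ℂ< {z} {r} {q} 0≤r r<q z≲r =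
  -- One half of the gap absorbs the slack in `z≲r`, the other is the margin that `_<ℝ_` demands.
  let η = ½ * (q - r)
      0<η = half-pos (subst (_< q - r) (+-inverseʳ r) (+-monoˡ-< (- r) r<q))
      (N , N≤) = z≲r η 0<η
  in η , 0<η , N , λ n N≤n →
    let w = normSq (seq (re z) n) (seq (im z) n) in begin
    sqrtℚ w n + η      ≤⟨ +-monoˡ-≤ η {sqrtℚ w n} {r + η} (square-cancel-≤ {sqrtℚ w n} (+-nonNeg 0≤r (<⇒≤ 0<η)) (≤-trans
                            (subst (sqrtℚ w n * sqrtℚ w n ≤_) (normSq-⊔ (seq (re z) n) (seq (im z) n)) (sqrtℚ-lower w n)) (N≤ n N≤n))) ⟩
    r + η + η          ≡⟨ trans (+-assoc r η η) (cong (r +_) (halves (q - r))) ⟩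
    r + (q - r)        ≡⟨ lem r q ⟩
    q                  ∎
  where
  open ≤-Reasoning
  lem : ∀ r q → r + (q - r) ≡ q
  lem = solve-∀ ℚ-ring

∣∣ℂ<⇒∥∥≲ : ∀ {z q} → ∣ z ∣ℂ <ℝ fromℚ q → ∥ z ∥≲ q
∣∣ℂ<⇒∥∥≲ {z} {q} (η , 0<η , M , M≤) ε 0<ε =
  let (N , N≤) = 1/1+-archimedean ε 0<ε
  in M ℕ.+ N , λ n n≥ →
    let w = normSq (seq (re z) n) (seq (im z) n) in begin
    w                                                    ≡⟨ normSq-⊔ (seq (re z) n) (seq (im z) n) ⟨
    0ℚ ⊔ w                                               ≤⟨ sqrtℚ-upper w n ⟩
    (sqrtℚ w n + 1/1+ n) * (sqrtℚ w n + 1/1+ n)          ≤⟨ square-mono-≤ {sqrtℚ w n + 1/1+ n} (+-nonNeg (sqrtℚ-nonNeg w n) (1/1+-nonNeg n))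
      (+-mono-≤ {sqrtℚ w n} {q} (≤-trans (p≤p+ {sqrtℚ w n} {η} (<⇒≤ 0<η)) (M≤ n (ℕ.m+n≤o⇒m≤o M n≥)))
                (≤-trans (1/1+-anti (ℕ.m+n≤o⇒n≤o M n≥)) N≤)) ⟩
    (q + ε) * (q + ε)                                    ∎
  where open ≤-Reasoning

-- The constant 4: N r ≤ 1 + δ + δ r gives first r ≤ 3 and then N r ≤ 1 + 4 δ.
reciprocal-near : ∀ {N q E r δ} → 1ℚ ≤ N → 0ℚ ≤ q → q * N ≡ 1ℚ → 0ℚ ≤ δ → δ ≤ ½ →
  N ≤ E + δ → E * r ≤ 1ℚ + δ → 1ℚ ≤ E * r + δ → ∣ r ∣ ≤ q + fromℕ 4 * δ
reciprocal-near {N} {q} {E} {r} {δ} 1≤N 0≤q qN≡1 0≤δ δ≤½ N≤E+δ Er≤ 1≤Er with ≤-total 0ℚ r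
... | inj₁ 0≤r = subst (_≤ q + fromℕ 4 * δ) (sym (0≤p⇒∣p∣≡p 0≤r)) (begin
  r                                   ≡⟨ *-identityˡ r ⟨
  1ℚ * r                              ≡⟨ cong (_* r) qN≡1 ⟨
  q * N * r                           ≡⟨ *-assoc q N r ⟩
  q * (N * r)                         ≤⟨ ≤-*ˡ 0≤q (≤-trans Nr≤ (+-monoʳ-≤ (1ℚ + δ) (≤-*ˡ 0≤δ r≤3))) ⟩
  q * (1ℚ + δ + δ * fromℕ 3)          ≡⟨ lem₂ q δ (fromℕ 3) ⟩
  q + q * ((fromℕ 3 + 1ℚ) * δ)        ≤⟨ +-monoʳ-≤ q (≤-*ʳ (*-nonNeg (fromℕ-nonNeg 4) 0≤δ) q≤1) ⟩
  q + 1ℚ * (fromℕ 4 * δ)              ≡⟨ cong (q +_) (*-identityˡ (fromℕ 4 * δ)) ⟩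
  q + fromℕ 4 * δ                     ∎)
  where
  open ≤-Reasoning
  lem₁ : ∀ e d r → (e + d) * r ≡ e * r + d * r
  lem₁ e d r = *-distribʳ-+ r e d
  lem₂ : ∀ q d t → q * (1ℚ + d + d * t) ≡ q + q * ((t + 1ℚ) * d)
  lem₂ = solve-∀ ℚ-ring
  lem₃ : ∀ r h → r ≡ r - h * r + h * r
  lem₃ = solve-∀ ℚ-ring
  q≤1 : q ≤ 1ℚ
  q≤1 = subst₂ _≤_ (*-identityʳ q) qN≡1 (≤-*ˡ 0≤q 1≤N)
  Nr≤ : N * r ≤ 1ℚ + δ + δ * r
  Nr≤ = ≤-trans (≤-*ʳ 0≤r N≤E+δ) (≤-trans (≤-reflexive (lem₁ E δ r)) (+-monoˡ-≤ (δ * r) Er≤))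
  r≤3 : r ≤ fromℕ 3
  r≤3 = begin
    r                                        ≡⟨ lem₄ r ⟩
    2ℚ * (r - ½ * r)                         ≤⟨ ≤-*ˡ (nonNegative⁻¹ 2ℚ) (p-q≤r {r} {½ * r} (begin
      r                                        ≡⟨ *-identityˡ r ⟨
      1ℚ * r                                   ≤⟨ ≤-trans (≤-*ʳ 0≤r 1≤N) Nr≤ ⟩
      1ℚ + δ + δ * r                           ≤⟨ +-mono-≤ (+-monoʳ-≤ 1ℚ δ≤½) (≤-*ʳ 0≤r δ≤½) ⟩
      1ℚ + ½ + ½ * r                           ≡⟨ +-comm (1ℚ + ½) (½ * r) ⟩
      ½ * r + (1ℚ + ½)                         ∎)) ⟩
    2ℚ * (1ℚ + ½)                            ≡⟨⟩
    fromℕ 3                                  ∎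
    where
    lem₄ : ∀ r → r ≡ 2ℚ * (r - ½ * r)
    lem₄ = solve-∀ ℚ-ring
-- `E` is nonnegative because `N` is at least 1 and `δ` at most ½, so `E * r` would be nonpositive,
-- whereas `1≤Er` forces it to be at least ½.
... | inj₂ r≤0 = contradiction (begin-strict
  ½                   <⟨ toWitness {a? = ½ <? 1ℚ} tt ⟩
  1ℚ                  ≤⟨ 1≤Er ⟩
  E * r + δ           ≤⟨ +-mono-≤ Er≤0 δ≤½ ⟩
  0ℚ + ½              ≡⟨⟩
  ½                   ∎) (<-irrefl refl)
  where
  open ≤-Reasoning
  0≤E : 0ℚ ≤ E
  0≤E = subst (0ℚ ≤_) (lem E δ) (0≤p-q {E + δ} {δ} (≤-trans δ≤½ (≤-trans (toWitness {a? = ½ ≤? 1ℚ} tt) (≤-trans 1≤N N≤E+δ))))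
    where
    lem : ∀ e d → e + d - d ≡ e
    lem = solve-∀ ℚ-ring
  Er≤0 : E * r ≤ 0ℚ
  Er≤0 = subst (E * r ≤_) (*-zeroʳ E) (≤-*ˡ 0≤E r≤0)

-- At a fixed index, `r` approximates the factor exp (- σ ln n) and `E` its reciprocal. Growth of
-- exp gives E ≥ N - δ, and `exp-neg` with both signs puts `E * r` within δ of 1; together they
-- bound `r`.
∥^-∥ : ∀ p σ t → fromℚ 2ℚ ≤ℝ σ → ∥ suc p ^- (σ +i t) ∥≲ 1/1+ p * 1/1+ p
∥^-∥ p σ t 2≤σ ε 0<ε =
  -- The 3 comes from (q + η)(1 + η) ≤ q + 3η, valid for q, η ≤ 1; the 4 and the ½ come from
  -- `reciprocal-near`.
  let (η , 0<η , η≤1 , 3η≤ε) = shrink (fromℕ 3) 1ℚ ε (fromℕ-nonNeg 3) 0<1ℚ 0<ε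
      (δ , 0<δ , δ≤½ , 4δ≤η) = shrink (fromℕ 4) ½ η (fromℕ-nonNeg 4) (positive⁻¹ ½) 0<η
      (N₁ , N₁≤) = fromℕ²≤exp-ln* p {σ} 2≤σ δ 0<δ
      (N₂ , N₂≤) = exp-neg 1ℚ ≤-refl X δ 0<δ
      (N₃ , N₃≤) = exp-neg -1ℚ ≤-refl X δ 0<δ
      (N₄ , N₄≤) = cos²+sin²≤1 Y η 0<η
  in N₁ ℕ.+ N₂ ℕ.+ N₃ ℕ.+ N₄ , λ n n≥ →
    let n≥₁₂₃ = ℕ.m+n≤o⇒m≤o (N₁ ℕ.+ N₂ ℕ.+ N₃) n≥
        n≥₁₂ = ℕ.m+n≤o⇒m≤o (N₁ ℕ.+ N₂) n≥₁₂₃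
        E = seq (exp X) n
        r = seq (exp X′) n
        C = seq (cos Y) n
        S = seq (sin Y) n
        r≡ : seq (exp (-ℝ X)) n ≡ r
        -- `_^-_` negates the logarithm before multiplying by `σ`, `exp-neg` negates the product;
        -- the approximations agree index by index.
        r≡ = cong (λ x → Series.partial expCoeff ∣expCoeff∣≤1 x n) (neg-distribˡ-* (lnApprox (suc p) n) (seq σ n))
        Er≤ : E * r ≤ 1ℚ + δ
        Er≤ = subst (_≤ 1ℚ + δ) (trans (*-identityˡ _) (cong (E *_) r≡)) (N₂≤ n (ℕ.m+n≤o⇒n≤o N₁ n≥₁₂))
        1≤Er : 1ℚ ≤ E * r + δ
        1≤Er = subst₂ _≤_ (lem₁ (E * r)) (lem₂ (E * r) δ)
          (+-monoʳ-≤ (E * r + 1ℚ) (subst (λ x → -1ℚ * (E * x) ≤ -1ℚ + δ) r≡ (N₃≤ n (ℕ.m+n≤o⇒n≤o (N₁ ℕ.+ N₂) n≥₁₂₃))))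
        ∣r∣≤ : ∣ r ∣ ≤ q + η
        ∣r∣≤ = ≤-trans (reciprocal-near {N} {q} {E} {r} {δ} 1≤N 0≤q qN≡1 (<⇒≤ 0<δ) δ≤½ (N₁≤ n (ℕ.m+n≤o⇒m≤o N₁ n≥₁₂)) Er≤ 1≤Er)
          (+-monoʳ-≤ q 4δ≤η)
        0≤q+η = +-nonNeg 0≤q (<⇒≤ 0<η)
        0≤1+η = +-nonNeg (<⇒≤ 0<1ℚ) (<⇒≤ 0<η)
    in begin
    normSq (r * C) (r * S)                                        ≡⟨ lem₃ r C S ⟩
    r * r * normSq C S                                            ≤⟨ *-mono-≤′ (+-nonNeg (square-nonNeg C) (square-nonNeg S)) (square-nonNeg (q + η)) (*-≤-abs {r} {r} ∣r∣≤ ∣r∣≤)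
                                                                       (≤-trans (N₄≤ n (ℕ.m+n≤o⇒n≤o (N₁ ℕ.+ N₂ ℕ.+ N₃) n≥)) (1+η≤ (<⇒≤ 0<η))) ⟩
    (q + η) * (q + η) * ((1ℚ + η) * (1ℚ + η))                     ≡⟨ lem₄ (q + η) (1ℚ + η) ⟩
    ((q + η) * (1ℚ + η)) * ((q + η) * (1ℚ + η))                   ≤⟨ square-mono-≤ (*-nonNeg 0≤q+η 0≤1+η) (≤-trans (product≤ (<⇒≤ 0<η) η≤1) (+-monoʳ-≤ q 3η≤ε)) ⟩
    (q + ε) * (q + ε)                                             ∎
  where
  open ≤-Reasoning
  X X′ Y : ℝ
  X = ln (suc p) *ℝ σ
  X′ = (-ℝ ln (suc p)) *ℝ σ
  Y = (-ℝ ln (suc p)) *ℝ t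
  N q : ℚ
  N = fromℕ (suc p) * fromℕ (suc p)
  q = 1/1+ p * 1/1+ p
  0≤q : 0ℚ ≤ q
  0≤q = square-nonNeg (1/1+ p)
  1≤N : 1ℚ ≤ N
  1≤N = square-mono-≤ {1ℚ} (<⇒≤ 0<1ℚ) (fromℕ-mono-≤ {1} {suc p} (s≤s z≤n))
  1/1+p≤1 : 1/1+ p ≤ 1ℚ
  1/1+p≤1 = 1/1+-anti {0} {p} z≤n
  q≤1 : q ≤ 1ℚ
  q≤1 = square-mono-≤ (1/1+-nonNeg p) 1/1+p≤1
  qN≡1 : q * N ≡ 1ℚ
  qN≡1 = trans (lem₀ (1/1+ p) (fromℕ (suc p))) (cong (λ x → x * x) (fromℕ*1/ p))
    where
    lem₀ : ∀ r k → r * r * (k * k) ≡ k * r * (k * r)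
    lem₀ = solve-∀ ℚ-ring
  lem₁ : ∀ e → e + 1ℚ + -1ℚ * e ≡ 1ℚ
  lem₁ = solve-∀ ℚ-ring
  lem₂ : ∀ e d → e + 1ℚ + (-1ℚ + d) ≡ e + d
  lem₂ = solve-∀ ℚ-ring
  lem₃ : ∀ r c s → r * c * (r * c) + r * s * (r * s) ≡ r * r * (c * c + s * s)
  lem₃ = solve-∀ ℚ-ring
  lem₄ : ∀ x y → x * x * (y * y) ≡ x * y * (x * y)
  lem₄ = solve-∀ ℚ-ring
  -- Weakening the bound on cos² + sin² to a square makes the whole bound a perfect square.
  1+η≤ : ∀ {η} → 0ℚ ≤ η → 1ℚ + η ≤ (1ℚ + η) * (1ℚ + η)
  1+η≤ {η} 0≤η = subst (_≤ (1ℚ + η) * (1ℚ + η)) (*-identityʳ (1ℚ + η)) (≤-*ˡ (+-nonNeg (<⇒≤ 0<1ℚ) 0≤η) (p≤p+ 0≤η))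
  product≤ : ∀ {η} → 0ℚ ≤ η → η ≤ 1ℚ → (q + η) * (1ℚ + η) ≤ q + fromℕ 3 * η
  product≤ {η} 0≤η η≤1 = begin
    (q + η) * (1ℚ + η)                ≡⟨ lem₅ q η ⟩
    q + (q + (1ℚ + η)) * η            ≤⟨ +-monoʳ-≤ q (≤-*ʳ 0≤η (+-mono-≤ q≤1 (+-monoʳ-≤ 1ℚ η≤1))) ⟩
    q + fromℕ 3 * η                   ∎
    where
    lem₅ : ∀ q e → (q + e) * (1ℚ + e) ≡ q + (q + (1ℚ + e)) * e
    lem₅ = solve-∀ ℚ-ring

-- The Dirichlet series

invSqSum rate : ℕ → ℚ
invSqSum = sum (λ k → 1/1+ k * 1/1+ k)
rate n = 1/1+ n + 1/1+ n

rate-nonNeg : ∀ n → 0ℚ ≤ rate n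
rate-nonNeg n = +-nonNeg (1/1+-nonNeg n) (1/1+-nonNeg n)

invSqSum-mono : ∀ {m n} → m ℕ.≤ n → invSqSum m ≤ invSqSum n
invSqSum-mono = sum-extend (λ k → square-nonNeg (1/1+ k))

-- With x = 1/(n + 1) and y = 1/(n + 2), x - y = x y and x ≤ 2y, so x² ≤ 2 x y = 2x - 2y. The factor
-- 2 lets the bound start at n = 0.
invSqSum+rate-anti : ∀ {m n} → m ℕ.≤ n → invSqSum n + rate n ≤ invSqSum m + rate m
invSqSum+rate-anti = anti-from (λ n → invSqSum n + rate n) 0 (λ n _ → step n) z≤n
  where
  open ≤-Reasoning
  step : ∀ n → invSqSum (suc n) + rate (suc n) ≤ invSqSum n + rate n
  step n = begin
    invSqSum n + x * x + (y + y)             ≡⟨ +-assoc (invSqSum n) (x * x) (y + y) ⟩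
    invSqSum n + (x * x + (y + y))           ≤⟨ +-monoʳ-≤ (invSqSum n) (+-monoˡ-≤ (y + y) (≤-*ˡ (1/1+-nonNeg n) x≤2y)) ⟩
    invSqSum n + (x * (y + y) + (y + y))     ≡⟨ cong (invSqSum n +_) (lem₁ x y) ⟩
    invSqSum n + (y + x * y + (y + x * y))   ≡⟨ cong (λ z → invSqSum n + (z + z)) x≡ ⟨
    invSqSum n + (x + x)                     ∎
    where
    x y : ℚ
    x = 1/1+ n
    y = 1/1+ (suc n)
    lem₁ : ∀ x y → x * (y + y) + (y + y) ≡ y + x * y + (y + x * y)
    lem₁ = solve-∀ ℚ-ring
    lem₂ : ∀ x y k → x * ((k + 1ℚ) * y) ≡ k * x * y + x * y
    lem₂ = solve-∀ ℚ-ring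
    x≡ : x ≡ y + x * y
    x≡ = begin-equality
      x                                 ≡⟨ trans (cong (x *_) (fromℕ*1/ (suc n))) (*-identityʳ x) ⟨
      x * (fromℕ (suc (suc n)) * y)     ≡⟨ cong (λ k → x * (k * y)) (fromℕ-suc (suc n)) ⟩
      x * ((fromℕ (suc n) + 1ℚ) * y)    ≡⟨ lem₂ x y (fromℕ (suc n)) ⟩
      fromℕ (suc n) * x * y + x * y     ≡⟨ cong (_+ x * y) (trans (cong (_* y) (fromℕ*1/ n)) (*-identityˡ y)) ⟩
      y + x * y                         ∎
    x≤2y : x ≤ y + y
    x≤2y = subst (_≤ y + y) (sym x≡) (+-monoʳ-≤ y (subst (x * y ≤_) (*-identityˡ y)
      (≤-*ʳ (1/1+-nonNeg (suc n)) (1/1+-anti {0} {n} z≤n))))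

invSqSum-tail : ∀ {m n} → m ℕ.≤ n → invSqSum n - invSqSum m ≤ rate m
invSqSum-tail {m} {n} m≤n = p-q≤r {invSqSum n} {invSqSum m} (≤-trans (p≤p+ (rate-nonNeg n)) (invSqSum+rate-anti m≤n))

module ZetaPartial {σ t : ℝ} (2≤σ : fromℚ 2ℚ ≤ℝ σ) where

  Z : ℕ → ℂ
  Z = ζ-partial (σ +i t)

  Z-diff : ∀ {m n} → m ℕ.≤ n → ∥ Z n -ℂ Z m ∥≲ invSqSum n - invSqSum m
  Z-diff {m} {n} m≤n with ℕ.m≤n⇒m<n∨m≡n m≤n
  Z-diff {m} {suc n} _ | inj₁ (s≤s m≤n) = subst (∥ Z (suc n) -ℂ Z m ∥≲_) (lem (invSqSum n) (invSqSum m) (1/1+ n * 1/1+ n))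
    (∥∥≲-triangle {Z (suc n) -ℂ Z m} {Z n -ℂ Z m} {suc n ^- (σ +i t)} (0≤p-q (invSqSum-mono m≤n)) (square-nonNeg (1/1+ n))
      (λ k → lem′ (seq (re (Z n)) k) (seq (re (Z m)) k) (seq (re (suc n ^- (σ +i t))) k))
      (λ k → lem′ (seq (im (Z n)) k) (seq (im (Z m)) k) (seq (im (suc n ^- (σ +i t))) k))
      (Z-diff m≤n) (∥^-∥ n σ t 2≤σ))
    where
    lem : ∀ p q r → p - q + r ≡ p + r - q
    lem = solve-∀ ℚ-ring
    lem′ : ∀ p q r → p + r - q ≡ p - q + r
    lem′ = solve-∀ ℚ-ring
  Z-diff {m} _ | inj₂ refl = λ ε 0<ε → 0 , λ k _ → begin
    normSq (seq (re (Z m)) k - seq (re (Z m)) k) (seq (im (Z m)) k - seq (im (Z m)) k)  ≡⟨ cong₂ normSq (+-inverseʳ (seq (re (Z m)) k)) (+-inverseʳ (seq (im (Z m)) k)) ⟩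
    0ℚ                                  ≤⟨ square-nonNeg (invSqSum m - invSqSum m + ε) ⟩
    (invSqSum m - invSqSum m + ε) * (invSqSum m - invSqSum m + ε)   ∎
    where open ≤-Reasoning

  ζ<2 : ∀ z → ζ[ σ +i t ]≈ z → ∣ z ∣ℂ <ℝ fromℚ 2ℚ
  ζ<2 z Z⟶z =
    -- The bound `invSqSum m + rate m` is exactly 2 at m = 0 and m = 1; m = 2 is the first cut that
    -- falls below, to 23/12. Half of the gap 1/12, that is 1/24, pays for the distance from the
    -- partial sum to `z`.
    let ε = 1/1+ 23
        (N , N≤) = Z⟶z ε (1/1+-pos 23)
        n = 2 ℕ.+ N
        Z-z = ∣∣ℂ<⇒∥∥≲ {Z n -ℂ z} (N≤ n (ℕ.m≤n+m N 2))
    in ∥∥≲⇒∣∣ℂ< {z} {invSqSum 2 + rate 2 + ε} {2ℚ} (nonNegative⁻¹ (invSqSum 2 + rate 2 + ε)) (toWitness {a? = invSqSum 2 + rate 2 + ε <? 2ℚ} tt)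
      -- `Z 0` is `0ℂ`, so the partial sum itself is bounded by `Z-diff` from 0.
      (∥∥≲-triangle {z} {Z n -ℂ Z 0} {z -ℂ Z n} (nonNegative⁻¹ (invSqSum 2 + rate 2)) (1/1+-nonNeg 23)
        (λ k → lem (seq (re z) k) (seq (re (Z n)) k)) (λ k → lem (seq (im z) k) (seq (im (Z n)) k))
        (∥∥≲-mono {Z n -ℂ Z 0} (0≤p-q (invSqSum-mono {0} {n} z≤n)) (invSqSum-bound n (ℕ.m≤m+n 2 N)) (Z-diff {0} {n} z≤n))
        (∥∥≲-sym {Z n} {z} {ε} Z-z))
    where
    lem : ∀ z p → z ≡ p - 0ℚ + (z - p)
    lem = solve-∀ ℚ-ring
    invSqSum-bound : ∀ n → 2 ℕ.≤ n → invSqSum n - invSqSum 0 ≤ invSqSum 2 + rate 2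
    invSqSum-bound n 2≤n = ≤-trans (≤-reflexive (+-identityʳ (invSqSum n))) (≤-trans (p≤p+ (rate-nonNeg n)) (invSqSum+rate-anti 2≤n))

-- Completeness of the reals and convergence of the series

module Completeness (f : ℕ → ℝ)
  (near : ∀ m n → m ℕ.≤ n → ∀ ε → 0ℚ < ε → ∃[ K ] ∀ k → K ℕ.≤ k → ∣ seq (f n) k - seq (f m) k ∣ ≤ rate m + ε) where
  open ≤-Reasoning

  -- The plain diagonal `seq (f n) n` need not be Cauchy, since the `f n` may settle at different
  -- speeds. Reading `f n` where it has settled to within `1/1+ n` repairs this.
  index : ℕ → ℕ
  index n = proj₁ (cauchy (f n) (1/1+ n) (1/1+-pos n))

  diagonal : ℕ → ℚ
  diagonal n = seq (f n) (index n)

  diagonal-near : ∀ n k → index n ℕ.≤ k → ∣ seq (f n) k - diagonal n ∣ ≤ 1/1+ n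
  diagonal-near n k le = proj₂ (cauchy (f n) (1/1+ n) (1/1+-pos n)) k (index n) le ℕ.≤-refl

  -- Both diagonal entries are compared at a common late index `k`: two units for reaching `k`, two
  -- for `rate m`, one for the slack in `near`.
  diagonal-cauchy : ∀ {m n} → m ℕ.≤ n → ∣ diagonal n - diagonal m ∣ ≤ fromℕ 5 * 1/1+ m
  diagonal-cauchy {m} {n} m≤n =
    let (K , K≤) = near m n m≤n (1/1+ m) (1/1+-pos m)
        k = K ℕ.+ index m ℕ.+ index n
    in begin
    ∣ diagonal n - diagonal m ∣                                                 ≤⟨ ∣-∣-triangle (diagonal n) (seq (f n) k) (diagonal m) ⟩
    ∣ diagonal n - seq (f n) k ∣ + ∣ seq (f n) k - diagonal m ∣                 ≤⟨ +-mono-≤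
      (≤-trans (≤-reflexive (∣p-q∣≡∣q-p∣ (diagonal n) (seq (f n) k))) (≤-trans (diagonal-near n k (ℕ.m≤n+m (index n) (K ℕ.+ index m))) (1/1+-anti m≤n)))
      (≤-trans (∣-∣-triangle (seq (f n) k) (seq (f m) k) (diagonal m))
        (+-mono-≤ (K≤ k (ℕ.≤-trans (ℕ.m≤m+n K (index m)) (ℕ.m≤m+n _ (index n))))
          (diagonal-near m k (ℕ.≤-trans (ℕ.m≤n+m (index m) K) (ℕ.m≤m+n _ (index n)))))) ⟩
    1/1+ m + (1/1+ m + 1/1+ m + 1/1+ m + 1/1+ m)                                ≡⟨ lem (1/1+ m) ⟩
    fromℕ 5 * 1/1+ m                                                            ∎
    where
    lem : ∀ r → r + (r + r + r + r) ≡ (1ℚ + 1ℚ + 1ℚ + 1ℚ + 1ℚ) * r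
    lem = solve-∀ ℚ-ring

  limit : ℝ
  limit = record
    { seq    = diagonal
    ; cauchy = λ ε 0<ε →
        let (N , N≤) = *1/1+-archimedean (fromℕ 5) ε (fromℕ-nonNeg 5) 0<ε
            bound : ∀ {m n} → N ℕ.≤ m → m ℕ.≤ n → ∣ diagonal n - diagonal m ∣ ≤ ε
            bound N≤m m≤n = ≤-trans (diagonal-cauchy m≤n) (≤-trans (≤-*ˡ (fromℕ-nonNeg 5) (1/1+-anti N≤m)) N≤)
        in N , λ m n N≤m N≤n → bound-sym N m n N≤m N≤n bound
    }
    where
    bound-sym : ∀ N m n {ε} → N ℕ.≤ m → N ℕ.≤ n → (∀ {m n} → N ℕ.≤ m → m ℕ.≤ n → ∣ diagonal n - diagonal m ∣ ≤ ε) → ∣ diagonal m - diagonal n ∣ ≤ ε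
    bound-sym N m n {ε} N≤m N≤n bound with ℕ.≤-total m n
    ... | inj₁ m≤n = subst (_≤ ε) (∣p-q∣≡∣q-p∣ (diagonal n) (diagonal m)) (bound N≤m m≤n)
    ... | inj₂ n≤m = bound N≤n n≤m

  limit-near : ∀ n k → n ℕ.+ index n ℕ.≤ k → ∣ seq (f n) k - seq limit k ∣ ≤ fromℕ 6 * 1/1+ n
  limit-near n k k≥ = begin
    ∣ seq (f n) k - diagonal k ∣                                        ≤⟨ ∣-∣-triangle (seq (f n) k) (diagonal n) (diagonal k) ⟩
    ∣ seq (f n) k - diagonal n ∣ + ∣ diagonal n - diagonal k ∣          ≤⟨ +-mono-≤ (diagonal-near n k (ℕ.m+n≤o⇒n≤o n k≥))
      (subst (_≤ fromℕ 5 * 1/1+ n) (∣p-q∣≡∣q-p∣ (diagonal k) (diagonal n)) (diagonal-cauchy (ℕ.m+n≤o⇒m≤o n k≥))) ⟩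
    1/1+ n + fromℕ 5 * 1/1+ n                                           ≡⟨ lem (1/1+ n) (fromℕ 5) ⟩
    (1ℚ + fromℕ 5) * 1/1+ n                                             ∎
    where
    lem : ∀ r c → r + c * r ≡ (1ℚ + c) * r
    lem = solve-∀ ℚ-ring

module ZetaLimit {σ t : ℝ} (2≤σ : fromℚ 2ℚ ≤ℝ σ) where
  open ZetaPartial {σ} {t} 2≤σ

  near : ∀ m n → m ℕ.≤ n → ∀ ε → 0ℚ < ε → ∃[ K ] ∀ k → K ℕ.≤ k →
    normSq (seq (re (Z n)) k - seq (re (Z m)) k) (seq (im (Z n)) k - seq (im (Z m)) k) ≤ (rate m + ε) * (rate m + ε)
  near m n m≤n = ∥∥≲-mono {Z n -ℂ Z m} (0≤p-q (invSqSum-mono m≤n)) (invSqSum-tail m≤n) (Z-diff m≤n)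

  re-near : ∀ m n → m ℕ.≤ n → ∀ ε → 0ℚ < ε → ∃[ K ] ∀ k → K ℕ.≤ k → ∣ seq (re (Z n)) k - seq (re (Z m)) k ∣ ≤ rate m + ε
  re-near m n m≤n ε 0<ε =
    let (K , K≤) = near m n m≤n ε 0<ε
    in K , λ k K≤k → normSq⇒∣∣ˡ {_} {seq (im (Z n)) k - seq (im (Z m)) k} (+-nonNeg (rate-nonNeg m) (<⇒≤ 0<ε)) (K≤ k K≤k)

  im-near : ∀ m n → m ℕ.≤ n → ∀ ε → 0ℚ < ε → ∃[ K ] ∀ k → K ℕ.≤ k → ∣ seq (im (Z n)) k - seq (im (Z m)) k ∣ ≤ rate m + ε
  im-near m n m≤n ε 0<ε =
    let (K , K≤) = near m n m≤n ε 0<ε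
    in K , λ k K≤k →
      let a = seq (re (Z n)) k - seq (re (Z m)) k
          b = seq (im (Z n)) k - seq (im (Z m)) k
      in normSq⇒∣∣ˡ {b} {a} (+-nonNeg (rate-nonNeg m) (<⇒≤ 0<ε))
        (subst (_≤ (rate m + ε) * (rate m + ε)) (+-comm (a * a) (b * b)) (K≤ k K≤k))

  module Re = Completeness (λ n → re (Z n)) re-near
  module Im = Completeness (λ n → im (Z n)) im-near

  ζ-value : ℂ
  ζ-value = Re.limit +i Im.limit

  Z⟶ζ-value : Z ⟶ ζ-value
  Z⟶ζ-value ε 0<ε =
    -- Each coordinate is within 6/(1 + n) of its limit, and `∣∣⇒normSq` doubles the bound; aiming
    -- at half of `ε` leaves the strict margin.
    let (N , N≤) = *1/1+-archimedean (fromℕ 12) (½ * ε) (fromℕ-nonNeg 12) (half-pos 0<ε)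
    in N , λ n N≤n → ∥∥≲⇒∣∣ℂ< {Z n -ℂ ζ-value} {½ * ε} {ε} (<⇒≤ (half-pos 0<ε))
      (subst₂ _<_ (+-identityʳ (½ * ε)) (halves ε) (+-monoʳ-< (½ * ε) (half-pos 0<ε)))
      (∥∥≲-mono {Z n -ℂ ζ-value} (*-nonNeg (fromℕ-nonNeg 12) (1/1+-nonNeg n)) (≤-trans (≤-*ˡ (fromℕ-nonNeg 12) (1/1+-anti N≤n)) N≤) (bound n))
    where
    bound : ∀ n → ∥ Z n -ℂ ζ-value ∥≲ fromℕ 12 * 1/1+ n
    bound n ε 0<ε = (n ℕ.+ Re.index n) ℕ.+ (n ℕ.+ Im.index n) , λ k k≥ → ≤-trans
      (∣∣⇒normSq {seq (re (Z n)) k - seq Re.limit k} {seq (im (Z n)) k - seq Im.limit k}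
        (Re.limit-near n k (ℕ.m+n≤o⇒m≤o (n ℕ.+ Re.index n) k≥)) (Im.limit-near n k (ℕ.m+n≤o⇒n≤o (n ℕ.+ Re.index n) k≥)))
      (square-mono-≤ (+-nonNeg 0≤6r 0≤6r) (≤-trans (≤-reflexive (sym (*-distribʳ-+ (1/1+ n) (fromℕ 6) (fromℕ 6)))) (p≤p+ (<⇒≤ 0<ε))))
      where
      0≤6r : 0ℚ ≤ fromℕ 6 * 1/1+ n
      0≤6r = *-nonNeg (fromℕ-nonNeg 6) (1/1+-nonNeg n)

proposition6 : (σ t : ℝ) → fromℚ 2ℚ ≤ℝ σ →
    (∃[ z ] ζ[ σ +i t ]≈ z) × (∀ z → ζ[ σ +i t ]≈ z → ∣ z ∣ℂ <ℝ fromℚ 2ℚ)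
proposition6 σ t 2≤σ = (ζ-value , Z⟶ζ-value) , ζ<2
  where
  open ZetaPartial {σ} {t} 2≤σ
  open ZetaLimit {σ} {t} 2≤σ
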